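{- Assume that $G\subseteq 2^\omega\times 2^\omega$ is a locally countable boldface $\mathbf{\Sigma}^1_2$ graph. Then $G$ is generated by a family $F=\{f_\alpha:\alpha<\omega_1\}$ of $\aleph_1$ boldface $\mathbf{\Delta}^1_2$ functions.
   Context: A graph is a symmetric, irreflexive relation $G\subseteq 2^\omega\times 2^\omega$; $x\mathrel G y$ means $\langle x,y\rangle\in G$. Its vertex set is $|G|=\{x:\exists y\,(x\mathrel G y)\}$. $G$ belongs to a pointclass if it does so as a set of pairs; likewise a function belongs to a pointclass if it does so as a set of pairs. $G$ is locally countable if for every $x\in|G|$ the set $\{y: x\mathrel G y\}$ is at most countable. $G$ is generated by a family $F$ of functions if each $f\in F$ is a function from some set $\operatorname{dom} f\subseteq|G|$ to $|G|$ (not necessarily with $\operatorname{dom} f=|G|$), and for all $x,y\in|G|$: $x\mathrel G y \iff \exists f\in F\,(x=f(y)\lor y=f(x))$, where an equality $y=f(x)$ means $x\in\operatorname{dom} f$ and $y=f(x)$. -}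

module Defs where

open import Data.Bool.Base using (Bool)
open import Data.Nat.Base using (ℕ; _<_)
open import Data.Product.Base using (∃; _×_; _,_; proj₁; proj₂)
open import Data.Sum.Base using (_⊎_)
open import Function.Bundles using (_⇔_; Injection)
open import Induction.WellFounded using (WellFounded)
open import Level using (0ℓ; suc)
open import Relation.Binary.Bundles using (Setoid; StrictTotalOrder)
open import Relation.Binary.Core using (Rel)
open import Relation.Binary.Definitions using (Symmetric; Irreflexive)
import Relation.Binary.Morphism.Construct.Composition as Composition
import Relation.Binary.Morphism.Construct.Identity as Identity
open import Relation.Binary.Morphism.Structures using (IsOrderIsomorphism)
open import Relation.Binary.PropositionalEquality.Core using (_≡_)
import Relation.Binary.PropositionalEquality.Properties as ≡
open import Relation.Unary using (Pred; _∈_; _⊆_; ∁)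
open import Relation.Unary.Relation.Binary.Equality using (≐-setoid)

Cantor Baire : Set
Cantor = ℕ → Bool
Baire  = ℕ → ℕ

data Space : Set where
  cantor baire : Space
  _⊗_          : Space → Space → Space

infixr 6 _⊗_

Point : Space → Set
Point cantor  = Cantor
Point baire   = Baire
Point (S ⊗ T) = Point S × Point T

Subset : Space → Set₁
Subset S = Pred (Point S) 0ℓ

-- For fixed x, the sets { y | Agree S n x y } form a base of neighbourhoods
-- of x in the product topology.
Agree : (S : Space) → ℕ → Rel (Point S) 0ℓ
Agree cantor  n x y               = ∀ i → i < n → x i ≡ y i
Agree baire   n x y               = ∀ i → i < n → x i ≡ y i
Agree (S ⊗ T) n (x , x′) (y , y′) = Agree S n x y × Agree T n x′ y′

Pointclass : Set₂
Pointclass = (S : Space) → Pred (Subset S) (suc 0ℓ)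

Open : (S : Space) → Pred (Subset S) 0ℓ
Open S U = ∀ x → x ∈ U → ∃ λ n → ∀ y → Agree S n x y → y ∈ U

Closed : (S : Space) → Pred (Subset S) 0ℓ
Closed S A = Open S (∁ A)

-- Closed subsets of the product are arbitrary, so the classes are boldface:
-- real parameters are absorbed into the closed set.
𝚺¹₁ 𝚷¹₁ 𝚺¹₂ 𝚷¹₂ 𝚫¹₂ : Pointclass
𝚺¹₁ S A = ∃ λ (C : Subset (S ⊗ baire)) →
            Closed (S ⊗ baire) C × (∀ x → x ∈ A ⇔ (∃ λ z → (x , z) ∈ C))
𝚷¹₁ S A = 𝚺¹₁ S (∁ A)
𝚺¹₂ S A = ∃ λ (C : Subset (S ⊗ baire)) →
            𝚷¹₁ (S ⊗ baire) C × (∀ x → x ∈ A ⇔ (∃ λ z → (x , z) ∈ C))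
𝚷¹₂ S A = 𝚺¹₂ S (∁ A)
𝚫¹₂ S A = 𝚺¹₂ S A × 𝚷¹₂ S A

record IsGraph (G : Rel Cantor 0ℓ) : Set where
  field
    sym    : Symmetric G
    irrefl : Irreflexive _≡_ G

∣_∣ᵛ : Rel Cantor 0ℓ → Pred Cantor 0ℓ
∣ G ∣ᵛ x = ∃ λ y → G x y

AtMostCountable : Pred Cantor 0ℓ → Set
AtMostCountable A = ∃ λ (code : Cantor → ℕ) →
  ∀ {x y} → x ∈ A → y ∈ A → code x ≡ code y → x ≡ y

LocallyCountable : Rel Cantor 0ℓ → Set
LocallyCountable G = ∀ x → x ∈ ∣ G ∣ᵛ → AtMostCountable (G x)

-- A partial function is identified with its set of pairs, so "x ∈ dom f and
-- y = f x" reads (x , y) ∈ f.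
IsFunction : Subset (cantor ⊗ cantor) → Set
IsFunction f = ∀ {x y z} → (x , y) ∈ f → (x , z) ∈ f → y ≡ z

dom ran : Subset (cantor ⊗ cantor) → Pred Cantor 0ℓ
dom f x = ∃ λ y → (x , y) ∈ f
ran f y = ∃ λ x → (x , y) ∈ f

record IsGeneratedBy {i} (G : Rel Cantor 0ℓ) {I : Set i}
                     (f : I → Subset (cantor ⊗ cantor)) : Set i where
  field
    isFunction : ∀ α → IsFunction (f α)
    dom⊆       : ∀ α → dom (f α) ⊆ ∣ G ∣ᵛ
    ran⊆       : ∀ α → ran (f α) ⊆ ∣ G ∣ᵛ
    generates  : ∀ x y → x ∈ ∣ G ∣ᵛ → y ∈ ∣ G ∣ᵛ →
                 G x y ⇔ (∃ λ α → (y , x) ∈ f α ⊎ (x , y) ∈ f α)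

record CountableWellOrder : Set₁ where
  field
    strictTotalOrder : StrictTotalOrder 0ℓ 0ℓ 0ℓ

  open StrictTotalOrder strictTotalOrder public
    using (Carrier; _≈_; module Eq)
    renaming (_<_ to _≺_; <-resp-≈ to ≺-resp-≈)

  field
    wellFounded : WellFounded _≺_
    countable   : Injection Eq.setoid (≡.setoid ℕ)

_≅_ : Rel CountableWellOrder 0ℓ
A ≅ B = ∃ λ (h : A.Carrier → B.Carrier) →
          IsOrderIsomorphism A._≈_ B._≈_ A._≺_ B._≺_ h
  where
  module A = CountableWellOrder A
  module B = CountableWellOrder B

≅-sym : Symmetric _≅_
≅-sym {A} {B} (h , iso) = h⁻¹ , record
  { isOrderMonomorphism = record
    { isOrderHomomorphism = record
      { cong = λ b≈b′ → H.injective
                 (Eq.trans (hh⁻¹ _) (Eq.trans b≈b′ (Eq.sym (hh⁻¹ _))))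
      ; mono = λ b≺b′ → H.cancel
                 (≺-resp₂ (Eq.sym (hh⁻¹ _)) (Eq.sym (hh⁻¹ _)) b≺b′)
      }
    ; injective = λ a≈a′ →
        Eq.trans (Eq.sym (hh⁻¹ _)) (Eq.trans (H.cong a≈a′) (hh⁻¹ _))
    ; cancel    = λ a≺a′ → ≺-resp₂ (hh⁻¹ _) (hh⁻¹ _) (H.mono a≺a′)
    }
  ; surjective = λ a → h a , λ b≈ha → H.injective (Eq.trans (hh⁻¹ _) b≈ha)
  }
  where
  module A = CountableWellOrder A
  open CountableWellOrder B
  module H = IsOrderIsomorphism iso

  h⁻¹ : Carrier → A.Carrier
  h⁻¹ b = proj₁ (H.surjective b)

  hh⁻¹ : ∀ b → h (h⁻¹ b) ≈ b
  hh⁻¹ b = proj₂ (H.surjective b) A.Eq.refl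

  ≺-resp₂ : ∀ {b b′ c c′} → b ≈ b′ → c ≈ c′ → b ≺ c → b′ ≺ c′
  ≺-resp₂ p q b≺c = proj₁ ≺-resp-≈ q (proj₂ ≺-resp-≈ p b≺c)

-- The underlying set of the ordinal ω₁: its elements are the countable
-- ordinals, i.e. the order types of countable well-orders.
ω₁ : Setoid (suc 0ℓ) 0ℓ
ω₁ = record
  { Carrier       = CountableWellOrder
  ; _≈_           = _≅_
  ; isEquivalence = record
    { refl  = λ {A} → _ , Identity.isOrderIsomorphism _ _
                            (CountableWellOrder.Eq.refl A)
    ; sym   = λ {A} {B} → ≅-sym {A} {B}
    ; trans = λ {A} {B} {C} (_ , p) (_ , q) →
                _ , Composition.isOrderIsomorphism
                      (CountableWellOrder.Eq.trans C) p q
    }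
  }

-- Sets of pairs up to extensional equality.  A family indexed by ω₁ is a
-- setoid map into this: it depends on an index only through its order type,
-- which bounds the number of members by ℵ₁.
PairSets : Setoid (suc 0ℓ) 0ℓ
PairSets = ≐-setoid (Point (cantor ⊗ cantor)) 0ℓ

{-# OPTIONS --safe #-}
module Submission where

-- The graph G consists of the pairs (x , y) such that, for some z, the section of a
-- certain closed set D at (x , y , z) is empty.  This section is the set of branches
-- of a tree, and it is empty exactly when the tree has a rank function g into a
-- countable well-order A.  With A fixed, being such a rank function is a closed
-- condition on (x , y , z , g) (Ranked-closed).  So G is a union of analytic sets
-- indexed by the countable ordinals, and each of them has countable sections.
--
-- Fix A and x.  The points y such that (x , y) is in the analytic set given by A
-- are those shown by the branches of a tree T.  The derivative of a tree drops the
-- nodes whose extensions all show compatible parts of y.  If its iteration did not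
-- exhaust T, the remaining nodes would carry a perfect set of points y (Kernel); so
-- it does exhaust T (countable⇒Eliminable), and by a countable stage
-- (Eliminable⇒Removed).  Hence each y is shown by a branch that survives up to a last
-- stage e and passes through a node t isolated at this stage (last-stage), and then
-- y is determined by x, e and t (isolated-unique).  For fixed A, e and t, these pairs
-- (x , y) form a partial function (Piece).  The stages of the derivative are Borel in
-- x (Removed-Borel), so this function is analytic, and therefore Δ¹₂ (𝚺¹₁⊆𝚫¹₂).
--
-- It remains to index the functions by single ordinals.  If the derivative is
-- iterated along B, both A and B are found in R = A + 1 + B + 1 + 1 + …, where A is
-- the part below some element a.  So R, together with one number n coding a, e and t,
-- determines the function (cover).  As R has no maximum, the ordinal R + n determines
-- the order type of R and the number n (+ₒ-unique).  The coding of a and e by numbers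
-- involves an enumeration of R, which is why R is first replaced by a representative
-- of its order type (Representatives).

open import Axiom.ExcludedMiddle using (ExcludedMiddle)
open import Axiom.Extensionality.Propositional using (Extensionality; lower-extensionality)
open import Data.Bool.Base using (Bool; true; false; not)
open import Data.Bool.Properties using (T-≡; not-¬)
open import Data.Empty using (⊥; ⊥-elim)
open import Data.Fin.Base using (toℕ) renaming (zero to fzero)
import Data.Fin.Induction as Fin
import Data.Fin.Properties as Fin
open import Data.List.Base using (List; []; _∷_; _++_; _∷ʳ_; length; map; applyUpTo)
open import Data.List.Properties
  using (length-map; length-++; length-applyUpTo; map-++; map-∘; map-cong; ++-assoc;
         ++-cancelˡ; map-applyUpTo; applyUpTo-∷ʳ; ∷-injectiveˡ; ∷-injectiveʳ)
open import Data.Nat.Base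
  using (ℕ; zero; suc; _+_; _∸_; _≤_; _<_; _⊔_; z≤n; s≤s; z<s; s<s)
import Data.Nat.Induction as ℕ
import Data.Nat.Properties as ℕ
open import Data.Product.Base using (∃; _×_; _,_; proj₁; proj₂; uncurry)
open import Data.Sum.Base using (_⊎_; inj₁; inj₂; [_,_]′) renaming (map to ⊎-map)
open import Function.Base using (_∘_; id)
open import Function.Bundles using (_⇔_; mk⇔; Equivalence; Func; Injection)
open import Function.Definitions using (StrictlySurjective)
open import Induction.WellFounded using (WellFounded; Acc; acc; module Subrelation)
open import Level using (0ℓ; lift; lower) renaming (suc to lsuc)
open import Relation.Binary.Bundles using (Setoid; StrictTotalOrder)
open import Relation.Binary.Construct.Add.Supremum.Equality
  using (⊤⁺≈⊤⁺; [≈]-injective) renaming (_≈⁺_ to Eq⁺; [_] to [_]≈)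
open import Relation.Binary.Construct.Add.Supremum.Strict
  using ([_]<⊤⁺; [<]-injective; <⁺-isStrictTotalOrder) renaming (_<⁺_ to Lt⁺; [_] to [_]<)
open import Relation.Binary.Core using (Rel)
open import Relation.Binary.Definitions using (Transitive; Trichotomous; tri<; tri≈; tri>)
open import Relation.Binary.Morphism.Structures using (IsOrderIsomorphism)
open import Relation.Binary.PropositionalEquality hiding ([_])
open import Relation.Binary.Structures using (IsStrictTotalOrder)
open import Relation.Nullary using (¬_; Dec; yes; no)
open import Relation.Nullary.Construct.Add.Supremum using (_⁺; ⊤⁺; [_])
open import Relation.Nullary.Decidable
  using (decidable-stable; does; map′; dec-true; toWitness; isYes≗does; does-⇔)
open import Relation.Unary using (Pred; ∁)
open import Defs

-- Countable sets and the coding of pairs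

-- A type is countable here if some sequence lists all of it; in particular it
-- is inhabited.
Countable : Set → Set
Countable I = ∃ λ (e : ℕ → I) → StrictlySurjective _≡_ e

-- A listing of I and a section of it.
module Enumeration {I : Set} (c : Countable I) where
  decode : ℕ → I
  decode = proj₁ c

  code : I → ℕ
  code i = proj₁ (proj₂ c i)

  decode-code : ∀ i → decode (code i) ≡ i
  decode-code i = proj₂ (proj₂ c i)

-- Cantor's walk along the diagonals of ℕ × ℕ.
next : ℕ × ℕ → ℕ × ℕ
next (zero  , n) = suc n , zero
next (suc m , n) = m , suc n

unpair : ℕ → ℕ × ℕ
unpair zero    = zero , zero
unpair (suc k) = next (unpair k)

private
  Visited : ℕ × ℕ → Set
  Visited p = ∃ λ k → unpair k ≡ p

  visit-next : ∀ {p} → Visited p → Visited (next p)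
  visit-next (k , eq) = suc k , cong next eq

  diagonal : ∀ m n → Visited (n + m , 0) → Visited (m , n)
  diagonal m zero    v = v
  diagonal m (suc n) v =
    visit-next (diagonal (suc m) n (subst (λ k → Visited (k , 0)) (sym (ℕ.+-suc n m)) v))

  axis : ∀ d → Visited (d , 0)
  axis zero    = 0 , refl
  axis (suc d) =
    visit-next (diagonal 0 d (subst (λ k → Visited (k , 0)) (sym (ℕ.+-identityʳ d)) (axis d)))

ℕ×ℕ-countable : Countable (ℕ × ℕ)
ℕ×ℕ-countable = unpair , λ (m , n) → diagonal m n (axis (n + m))

ℕ-countable : Countable ℕ
ℕ-countable = id , λ n → n , refl

abstract
  pair : ℕ → ℕ → ℕ
  pair m n = Enumeration.code ℕ×ℕ-countable (m , n)

  fst snd : ℕ → ℕ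
  fst k = proj₁ (unpair k)
  snd k = proj₂ (unpair k)

  fst-pair : ∀ m n → fst (pair m n) ≡ m
  fst-pair m n = cong proj₁ (Enumeration.decode-code ℕ×ℕ-countable (m , n))

  snd-pair : ∀ m n → snd (pair m n) ≡ n
  snd-pair m n = cong proj₂ (Enumeration.decode-code ℕ×ℕ-countable (m , n))

pair-injective : ∀ {m n m′ n′} → pair m n ≡ pair m′ n′ → m ≡ m′ × n ≡ n′
pair-injective {m} {n} {m′} {n′} eq =
  trans (sym (fst-pair m n)) (trans (cong fst eq) (fst-pair m′ n′)) ,
  trans (sym (snd-pair m n)) (trans (cong snd eq) (snd-pair m′ n′))

×-countable : ∀ {I J} → Countable I → Countable J → Countable (I × J)
×-countable c d =
  (λ k → C.decode (fst k) , D.decode (snd k)) ,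
  λ (i , j) → pair (C.code i) (D.code j) ,
    cong₂ _,_ (trans (cong C.decode (fst-pair (C.code i) (D.code j))) (C.decode-code i))
              (trans (cong D.decode (snd-pair (C.code i) (D.code j))) (D.decode-code j))
  where
  module C = Enumeration c
  module D = Enumeration d

Bool-countable : Countable Bool
Bool-countable = (λ { zero → false ; (suc _) → true }) ,
                 (λ { false → 0 , refl ; true → 1 , refl })

private
  listCode : List ℕ → ℕ
  listCode []      = 0
  listCode (k ∷ s) = suc (pair k (listCode s))

  listCode-injective : ∀ s t → listCode s ≡ listCode t → s ≡ t
  listCode-injective []      []      eq = refl
  listCode-injective (k ∷ s) (l ∷ t) eq =
    let k≡l , rest = pair-injective (ℕ.suc-injective eq)
    in cong₂ _∷_ k≡l (listCode-injective s t rest)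

-- Finite initial segments of sequences

-- The sequence of the first n values of u.  A finite sequence s is an initial
-- segment of u exactly when u ↾ length s ≡ s.
infix 8 _↾_
_↾_ : {A : Set} → (ℕ → A) → ℕ → List A
_↾_ = applyUpTo

module _ {A : Set} where

  ↾-cong : ∀ {u v : ℕ → A} n → (∀ i → i < n → u i ≡ v i) → u ↾ n ≡ v ↾ n
  ↾-cong zero    eq = refl
  ↾-cong (suc n) eq = cong₂ _∷_ (eq 0 z<s) (↾-cong n λ i i<n → eq (suc i) (s<s i<n))

  ↾-injective : ∀ {u v : ℕ → A} n → u ↾ n ≡ v ↾ n → ∀ i → i < n → u i ≡ v i
  ↾-injective (suc n) eq zero    _         = ∷-injectiveˡ eq
  ↾-injective (suc n) eq (suc i) (s≤s i<n) = ↾-injective n (∷-injectiveʳ eq) i i<n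

  ↾-+ : ∀ (u : ℕ → A) m n → u ↾ (m + n) ≡ u ↾ m ++ (λ i → u (m + i)) ↾ n
  ↾-+ u zero    n = refl
  ↾-+ u (suc m) n = cong (u 0 ∷_) (↾-+ (u ∘ suc) m n)

  ↾-length : ∀ (u : ℕ → A) n → u ↾ length (u ↾ n) ≡ u ↾ n
  ↾-length u n = cong (u ↾_) (length-applyUpTo u n)

  -- A sequence passing through s ++ t passes through s.
  ↾-++ˡ : ∀ (u : ℕ → A) s t → u ↾ length (s ++ t) ≡ s ++ t → u ↾ length s ≡ s
  ↾-++ˡ u []      t eq = refl
  ↾-++ˡ u (k ∷ s) t eq =
    cong₂ _∷_ (∷-injectiveˡ eq) (↾-++ˡ (u ∘ suc) s t (∷-injectiveʳ eq))

-- The product topology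

Agree-refl : ∀ S {n x} → Agree S n x x
Agree-refl cantor  i _ = refl
Agree-refl baire   i _ = refl
Agree-refl (S ⊗ T)     = Agree-refl S , Agree-refl T

Agree-sym : ∀ S {n x y} → Agree S n x y → Agree S n y x
Agree-sym cantor  a i i<n = sym (a i i<n)
Agree-sym baire   a i i<n = sym (a i i<n)
Agree-sym (S ⊗ T) (a , b) = Agree-sym S a , Agree-sym T b

Agree-trans : ∀ S {n x y z} → Agree S n x y → Agree S n y z → Agree S n x z
Agree-trans cantor  a b i i<n = trans (a i i<n) (b i i<n)
Agree-trans baire   a b i i<n = trans (a i i<n) (b i i<n)
Agree-trans (S ⊗ T) (a , b) (c , d) = Agree-trans S a c , Agree-trans T b d

Agree-≤ : ∀ S {m n x y} → m ≤ n → Agree S n x y → Agree S m x y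
Agree-≤ cantor  m≤n a i i<m = a i (ℕ.<-≤-trans i<m m≤n)
Agree-≤ baire   m≤n a i i<m = a i (ℕ.<-≤-trans i<m m≤n)
Agree-≤ (S ⊗ T) m≤n (a , b) = Agree-≤ S m≤n a , Agree-≤ T m≤n b

Continuous : (S T : Space) → (Point S → Point T) → Set
Continuous S T φ = ∀ n x → ∃ λ m → ∀ y → Agree S m x y → Agree T n (φ x) (φ y)

Open-preimage : ∀ S T {φ U} → Continuous S T φ → Open T U → Open S (U ∘ φ)
Open-preimage S T {φ} cont open-U x x∈U =
  let n , sub = open-U (φ x) x∈U
      m , mod = cont n x
  in m , λ y a → sub (φ y) (mod y a)

-- Membership is decided by a fixed finite amount of information about the
-- point, so that the set is clopen.
Finitary : (S : Space) → Subset S → Set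
Finitary S P = ∃ λ n → ∀ x y → Agree S n x y → P x → P y

Finitary⇒Open : ∀ S {P} → Finitary S P → Open S P
Finitary⇒Open S (n , det) x x∈P = n , λ y a → det x y a x∈P

Finitary-∁ : ∀ S {P} → Finitary S P → Finitary S (∁ P)
Finitary-∁ S (n , det) = n , λ x y a x∉P y∈P → x∉P (det y x (Agree-sym S a) y∈P)

Finitary⇒Closed : ∀ S {P} → Finitary S P → Closed S P
Finitary⇒Closed S = Finitary⇒Open S ∘ Finitary-∁ S

Finitary-→ : ∀ S {P Q} → Finitary S P → Finitary S Q → Finitary S (λ x → P x → Q x)
Finitary-→ S (m , det) (n , det′) = m ⊔ n , λ x y a f p →
  det′ x y (Agree-≤ S (ℕ.m≤n⊔m m n) a)
    (f (det y x (Agree-sym S (Agree-≤ S (ℕ.m≤m⊔n m n) a)) p))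

-- The tree of a closed set

-- For D ⊆ S × ℕ^ω, the tree of the section of D at p: the finite sequences
-- extended by some w for which (p′ , w) ∈ D, where p′ need only agree with p as
-- far as the length of the sequence.  Hence membership of a given sequence
-- depends on a finite part of p.
Tree : (S : Space) → Subset (S ⊗ baire) → Point S → Pred (List ℕ) 0ℓ
Tree S D p s = ∃ λ p′ → ∃ λ w →
  Agree S (length s) p p′ × w ↾ length s ≡ s × D (p′ , w)

module _ (S : Space) {D : Subset (S ⊗ baire)} where

  branch⇒Tree : ∀ {p w} → D (p , w) → ∀ n → Tree S D p (w ↾ n)
  branch⇒Tree {p} {w} d n = p , w , Agree-refl S , ↾-length w n , d

  Tree-++ˡ : ∀ {p} s t → Tree S D p (s ++ t) → Tree S D p s
  Tree-++ˡ s t (p′ , w , a , eq , d) =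
    p′ , w , Agree-≤ S (length-≤ s) a , ↾-++ˡ w s t eq , d
    where
    length-≤ : ∀ r → length r ≤ length (r ++ t)
    length-≤ []      = z≤n
    length-≤ (_ ∷ r) = s≤s (length-≤ r)

  Tree-finitary : ∀ s → Finitary S (λ p → Tree S D p s)
  Tree-finitary s = length s , λ p q a (p′ , w , a′ , eq , d) →
    p′ , w , Agree-trans S (Agree-sym S a) a′ , eq , d

-- Analytic and Borel sets, classically

module Projective (em : ExcludedMiddle 0ℓ) where

  dne : {P : Set} → ¬ ¬ P → P
  dne = decidable-stable em

  ¬∀⇒∃¬ : {I : Set} {P : I → Set} → ¬ (∀ i → P i) → ∃ λ i → ¬ P i
  ¬∀⇒∃¬ ¬∀ = dne λ ¬∃ → ¬∀ λ i → dne λ ¬Pi → ¬∃ (i , ¬Pi)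

  -- A map f that factors through the image of j extends to all of the codomain.
  extend : {X Y Z : Set} → Z → (j : X → Y) (f : X → Z) → (∀ a b → j a ≡ j b → f a ≡ f b) →
           ∃ λ (σ : Y → Z) → ∀ a → σ (j a) ≡ f a
  extend {X} {Y} {Z} z₀ j f resp = (λ y → pick (em {∃ λ a → j a ≡ y})) , λ a → picked em
    where
    pick : ∀ {y} → Dec (∃ λ a → j a ≡ y) → Z
    pick (yes (a , _)) = f a
    pick (no  _)       = z₀

    picked : ∀ {a} (d : Dec (∃ λ b → j b ≡ j a)) → pick d ≡ f a
    picked (yes (b , eq)) = resp b _ eq
    picked (no  ∄)        = ⊥-elim (∄ (_ , refl))

  injection⇒Countable : {I : Set} → I → (f : I → ℕ) →
                        (∀ i j → f i ≡ f j → i ≡ j) → Countable I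
  injection⇒Countable i₀ f inj =
    let e , e-f = extend i₀ f id inj in e , λ i → f i , e-f i

  List-countable : Countable (List ℕ)
  List-countable = injection⇒Countable [] listCode listCode-injective

  Closed-resp : ∀ S {C x y} → Closed S C → (∀ n → Agree S n x y) → C x → C y
  Closed-resp S {x = x} {y} closed-C a x∈C = dne λ y∉C →
    let n , sub = closed-C y y∉C in sub x (Agree-sym S (a n)) x∈C

  Closed-⋂ : ∀ S {I : Set} {C : I → Subset S} → (∀ i → Closed S (C i)) →
             Closed S (λ x → ∀ i → C i x)
  Closed-⋂ S closed-C x ¬∀ =
    let i , x∉Ci = ¬∀⇒∃¬ ¬∀
        n , sub  = closed-C i x x∉Ci
    in n , λ y a y∈C → sub y a (y∈C i)

  branch⇐Tree : ∀ S {D} → Closed (S ⊗ baire) D →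
                ∀ {p w} → (∀ n → Tree S D p (w ↾ n)) → D (p , w)
  branch⇐Tree S {D} closed-D {p} {w} tr = dne λ d →
    let n , sub            = closed-D (p , w) d
        p′ , v , a , eq , d′ = tr n
        len                = length-applyUpTo w n
    in sub (p′ , v)
         ( subst (λ k → Agree S k p p′) len a
         , ↾-injective n (sym (trans (cong (v ↾_) (sym len)) eq)))
         d′

  𝚺¹₁-resp : ∀ S {A B} → (∀ x → A x ⇔ B x) → 𝚺¹₁ S A → 𝚺¹₁ S B
  𝚺¹₁-resp S A⇔B (C , closed-C , A⇔C) = C , closed-C , λ x →
    mk⇔ (to (A⇔C x) ∘ from (A⇔B x)) (to (A⇔B x) ∘ from (A⇔C x))
    where open Equivalence

  Closed⇒𝚺¹₁ : ∀ S {A} → Closed S A → 𝚺¹₁ S A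
  Closed⇒𝚺¹₁ S {A} closed-A =
    (A ∘ proj₁) ,
    Open-preimage (S ⊗ baire) S {U = ∁ A} (λ n x → n , λ y → proj₁) closed-A ,
    λ x → mk⇔ (λ a → (λ _ → 0) , a) proj₂

  -- An open set is the projection of the closed set of all (x , z) such that
  -- the neighbourhood of x of index z 0 is contained in it.
  Open⇒𝚺¹₁ : ∀ S {A} → Open S A → 𝚺¹₁ S A
  Open⇒𝚺¹₁ S {A} open-A =
    C , closed-C , λ x →
      mk⇔ (λ a → let n , sub = open-A x a in (λ _ → n) , sub)
          (λ (z , sub) → sub x (Agree-refl S))
    where
    C : Subset (S ⊗ baire)
    C (x , z) = ∀ y → Agree S (z 0) x y → A y

    closed-C : Closed (S ⊗ baire) C
    closed-C (x , z) ∉C = z 0 ⊔ 1 , λ (x′ , z′) (a , b) sub → ∉C λ y a′ →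
      sub y (subst (λ n → Agree S n x′ y) (b 0 (ℕ.m≤n⊔m (z 0) 1))
              (Agree-trans S (Agree-sym S (Agree-≤ S (ℕ.m≤m⊔n (z 0) 1) a)) a′))

  𝚺¹₁-preimage : ∀ S T {φ A} → Continuous S T φ → 𝚺¹₁ T A → 𝚺¹₁ S (A ∘ φ)
  𝚺¹₁-preimage S T {φ} cont (C , closed-C , A⇔C) =
    (λ (x , z) → C (φ x , z)) ,
    Open-preimage (S ⊗ baire) (T ⊗ baire) {U = ∁ C} cont′ closed-C ,
    λ x → A⇔C (φ x)
    where
    cont′ : Continuous (S ⊗ baire) (T ⊗ baire) (λ (x , z) → φ x , z)
    cont′ n (x , z) =
      let m , mod = cont n x
      in m ⊔ n , λ (y , v) (a , b) →
           mod y (Agree-≤ S (ℕ.m≤m⊔n m n) a) , Agree-≤ baire (ℕ.m≤n⊔m m n) b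

  module _ {I : Set} (c : Countable I) where
    open Enumeration c

    𝚺¹₁-⋃ : ∀ S {A : I → Subset S} → (∀ i → 𝚺¹₁ S (A i)) →
            𝚺¹₁ S (λ x → ∃ λ i → A i x)
    𝚺¹₁-⋃ S {A} σ = C , closed-C , λ x →
      mk⇔ (λ (i , a) → let z , d = to (A⇔D i x) a in
             (λ { zero → code i ; (suc k) → z k }) ,
             subst (λ j → D j (x , z)) (sym (decode-code i)) d)
          (λ (z , d) → decode (z 0) , from (A⇔D (decode (z 0)) x) (z ∘ suc , d))
      where
      open Equivalence
      D : I → Subset (S ⊗ baire)
      D i = proj₁ (σ i)

      A⇔D : ∀ i x → A i x ⇔ (∃ λ z → D i (x , z))
      A⇔D i = proj₂ (proj₂ (σ i))

      -- The first entry of the witness selects the member of the union.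
      C : Subset (S ⊗ baire)
      C (x , z) = D (decode (z 0)) (x , z ∘ suc)

      closed-C : Closed (S ⊗ baire) C
      closed-C (x , z) ∉C =
        let n , sub = proj₁ (proj₂ (σ (decode (z 0)))) (x , z ∘ suc) ∉C
        in suc n , λ (y , v) (a , b) ∈C →
             sub (y , v ∘ suc)
               (Agree-≤ S (ℕ.n≤1+n n) a , λ i i<n → b (suc i) (s<s i<n))
               (subst (λ k → D (decode k) (y , v ∘ suc)) (sym (b 0 z<s)) ∈C)

    𝚺¹₁-⋂ : ∀ S {A : I → Subset S} → (∀ i → 𝚺¹₁ S (A i)) →
            𝚺¹₁ S (λ x → ∀ i → A i x)
    𝚺¹₁-⋂ S {A} σ = (λ p → ∀ k → C k p) , Closed-⋂ (S ⊗ baire) closed-C , λ x →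
      mk⇔ (λ a → let zs = λ k → proj₁ (to (A⇔D (decode k) x) (a (decode k))) in
             join zs ,
             λ k → Closed-resp (S ⊗ baire) (closed-D (decode k))
               (λ n → Agree-refl S , λ i _ → sym (column-join zs k i))
               (proj₂ (to (A⇔D (decode k) x) (a (decode k)))))
          (λ (z , d) i → subst (λ j → A j x) (decode-code i)
                           (from (A⇔D (decode (code i)) x) (column (code i) z , d (code i))))
      where
      open Equivalence
      D : I → Subset (S ⊗ baire)
      D i = proj₁ (σ i)

      closed-D : ∀ i → Closed (S ⊗ baire) (D i)
      closed-D i = proj₁ (proj₂ (σ i))

      A⇔D : ∀ i x → A i x ⇔ (∃ λ z → D i (x , z))
      A⇔D i = proj₂ (proj₂ (σ i))

      column : ℕ → Baire → Baire
      column k z j = z (pair k j)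

      join : (ℕ → Baire) → Baire
      join zs m = zs (fst m) (snd m)

      column-join : ∀ zs k j → column k (join zs) j ≡ zs k j
      column-join zs k j = cong₂ zs (fst-pair k j) (snd-pair k j)

      -- One witness codes the witnesses for all members of the intersection.
      C : (k : ℕ) → Subset (S ⊗ baire)
      C k (x , z) = D (decode k) (x , column k z)

      bound : ℕ → ℕ → ℕ
      bound k zero    = 0
      bound k (suc n) = bound k n ⊔ suc (pair k n)

      <-bound : ∀ k n j → j < n → pair k j < bound k n
      <-bound k (suc n) j (s≤s j≤n) with ℕ.m≤n⇒m<n∨m≡n j≤n
      ... | inj₁ j<n  = ℕ.≤-trans (<-bound k n j j<n) (ℕ.m≤m⊔n _ _)
      ... | inj₂ refl = ℕ.m≤n⊔m (bound k n) _

      closed-C : ∀ k → Closed (S ⊗ baire) (C k)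
      closed-C k = Open-preimage (S ⊗ baire) (S ⊗ baire) {U = ∁ (D (decode k))}
        (λ n (x , z) → n ⊔ bound k n , λ (y , v) (a , b) →
           Agree-≤ S (ℕ.m≤m⊔n n _) a ,
           λ j j<n → b (pair k j) (ℕ.≤-trans (<-bound k n j j<n) (ℕ.m≤n⊔m n _)))
        (closed-D (decode k))

  -- The two witnesses are coded entry by entry as one.
  𝚺¹₁-∃ : ∀ S {A} → 𝚺¹₁ (S ⊗ baire) A → 𝚺¹₁ S (λ x → ∃ λ z → A (x , z))
  𝚺¹₁-∃ S {A} (D , closed-D , A⇔D) = C , closed-C , λ x →
    mk⇔ (λ (z , a) → let w , d = to (A⇔D (x , z)) a in
           (λ i → pair (z i) (w i)) ,
           Closed-resp ((S ⊗ baire) ⊗ baire) closed-D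
             (λ n → (Agree-refl S , λ i _ → sym (fst-pair (z i) (w i))) ,
                    λ i _ → sym (snd-pair (z i) (w i))) d)
        (λ (v , d) → fst ∘ v , from (A⇔D _) (snd ∘ v , d))
    where
    open Equivalence
    C : Subset (S ⊗ baire)
    C (x , v) = D ((x , fst ∘ v) , snd ∘ v)

    closed-C : Closed (S ⊗ baire) C
    closed-C = Open-preimage (S ⊗ baire) ((S ⊗ baire) ⊗ baire) {U = ∁ D}
      (λ n (x , v) → n , λ (y , w) (a , b) →
         (a , λ i i<n → cong fst (b i i<n)) , λ i i<n → cong snd (b i i<n))
      closed-D

  𝚺¹₁-× : ∀ S {A B} → 𝚺¹₁ S A → 𝚺¹₁ S B → 𝚺¹₁ S (λ x → A x × B x)
  𝚺¹₁-× S {A} {B} σA σB = 𝚺¹₁-resp S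
    (λ x → mk⇔ (λ f → f false , f true) (λ (a , b) → λ { false → a ; true → b }))
    (𝚺¹₁-⋂ Bool-countable S {λ { false → A ; true → B }} λ { false → σA ; true → σB })

  𝚺¹₁-⊎ : ∀ S {A B} → 𝚺¹₁ S A → 𝚺¹₁ S B → 𝚺¹₁ S (λ x → A x ⊎ B x)
  𝚺¹₁-⊎ S {A} {B} σA σB = 𝚺¹₁-resp S
    (λ x → mk⇔ (λ { (false , a) → inj₁ a ; (true , b) → inj₂ b })
               [ false ,_ , true ,_ ]′)
    (𝚺¹₁-⋃ Bool-countable S {λ { false → A ; true → B }} λ { false → σA ; true → σB })

  𝚺¹₁⊆𝚫¹₂ : ∀ S {A} → 𝚺¹₁ S A → 𝚫¹₂ S A
  𝚺¹₁⊆𝚫¹₂ S {A} σ@(C , closed-C , A⇔C) =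
    (C , Open⇒𝚺¹₁ (S ⊗ baire) closed-C , A⇔C) ,
    (∁ A ∘ proj₁ ,
     𝚺¹₁-resp (S ⊗ baire) (λ x → mk⇔ (λ a ¬a → ¬a a) dne)
       (𝚺¹₁-preimage (S ⊗ baire) S (λ n x → n , λ y → proj₁) σ) ,
     λ x → mk⇔ (λ a → (λ _ → 0) , a) proj₂)

  -- Borel sets, in the form of the bianalytic sets.
  𝚫¹₁ : Pointclass
  𝚫¹₁ S A = 𝚺¹₁ S A × 𝚺¹₁ S (∁ A)

  𝚫¹₁-resp : ∀ S {A B} → (∀ x → A x ⇔ B x) → 𝚫¹₁ S A → 𝚫¹₁ S B
  𝚫¹₁-resp S A⇔B (σ , π) = 𝚺¹₁-resp S A⇔B σ ,
    𝚺¹₁-resp S (λ x → mk⇔ (_∘ from (A⇔B x)) (_∘ to (A⇔B x))) π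
    where open Equivalence

  𝚫¹₁-∁ : ∀ S {A} → 𝚫¹₁ S A → 𝚫¹₁ S (∁ A)
  𝚫¹₁-∁ S (σ , π) = π , 𝚺¹₁-resp S (λ x → mk⇔ (λ a ¬a → ¬a a) dne) σ

  Finitary⇒𝚫¹₁ : ∀ S {P} → Finitary S P → 𝚫¹₁ S P
  Finitary⇒𝚫¹₁ S f = Open⇒𝚺¹₁ S (Finitary⇒Open S f) ,
                     Open⇒𝚺¹₁ S (Finitary⇒Closed S f)

  𝚫¹₁-⊎ : ∀ S {A B} → 𝚫¹₁ S A → 𝚫¹₁ S B → 𝚫¹₁ S (λ x → A x ⊎ B x)
  𝚫¹₁-⊎ S (σ , π) (σ′ , π′) = 𝚺¹₁-⊎ S σ σ′ , 𝚺¹₁-resp S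
    (λ x → mk⇔ (λ (¬a , ¬b) → [ ¬a , ¬b ]′) (λ ¬ab → ¬ab ∘ inj₁ , ¬ab ∘ inj₂))
    (𝚺¹₁-× S π π′)

  -- For a proposition P that does not involve the point, it is enough to treat
  -- A under the assumption P.
  𝚫¹₁-→ : ∀ S {P : Set} {A} → (P → 𝚫¹₁ S A) → 𝚫¹₁ S (λ x → P → A x)
  𝚫¹₁-→ S {P} δ with em {P}
  ... | yes p = 𝚫¹₁-resp S (λ x → mk⇔ (λ a _ → a) (λ f → f p)) (δ p)
  ... | no ¬p = Finitary⇒𝚫¹₁ S (0 , λ _ _ _ _ p → ⊥-elim (¬p p))

  𝚫¹₁-×ˡ : ∀ S {P : Set} {A} → (P → 𝚫¹₁ S A) → 𝚫¹₁ S (λ x → P × A x)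
  𝚫¹₁-×ˡ S {P} δ with em {P}
  ... | yes p = 𝚫¹₁-resp S (λ x → mk⇔ (p ,_) proj₂) (δ p)
  ... | no ¬p = Finitary⇒𝚫¹₁ S (0 , λ _ _ _ (p , _) → ⊥-elim (¬p p))

  module _ {I : Set} (c : Countable I) where

    𝚫¹₁-⋃ : ∀ S {A : I → Subset S} → (∀ i → 𝚫¹₁ S (A i)) →
            𝚫¹₁ S (λ x → ∃ λ i → A i x)
    𝚫¹₁-⋃ S δ = 𝚺¹₁-⋃ c S (proj₁ ∘ δ) ,
      𝚺¹₁-resp S (λ x → mk⇔ (λ f (i , a) → f i a) (λ f i a → f (i , a)))
        (𝚺¹₁-⋂ c S (proj₂ ∘ δ))

    𝚫¹₁-⋂ : ∀ S {A : I → Subset S} → (∀ i → 𝚫¹₁ S (A i)) →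
            𝚫¹₁ S (λ x → ∀ i → A i x)
    𝚫¹₁-⋂ S δ = 𝚺¹₁-⋂ c S (proj₁ ∘ δ) ,
      𝚺¹₁-resp S (λ x → mk⇔ (λ (i , ¬a) f → ¬a (f i)) ¬∀⇒∃¬)
        (𝚺¹₁-⋃ c S (proj₂ ∘ δ))

-- Countable well-orders

open CountableWellOrder using (Carrier)

-- The number of an element in the enumeration that comes with A.
index : (A : CountableWellOrder) → Carrier A → ℕ
index A = Injection.to (CountableWellOrder.countable A)

≺-trans : (A : CountableWellOrder) → Transitive (CountableWellOrder._≺_ A)
≺-trans A = StrictTotalOrder.trans (CountableWellOrder.strictTotalOrder A)

-- The finite well-order with n elements.
finₒ : ℕ → CountableWellOrder
finₒ n = record
  { strictTotalOrder = Fin.<-strictTotalOrder n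
  ; wellFounded      = Fin.<-wellFounded
  ; countable        = record
    { to = toℕ ; cong = cong toℕ ; injective = Fin.toℕ-injective }
  }

-- The ordinal A + 1.
sucₒ : CountableWellOrder → CountableWellOrder
sucₒ A = record
  { strictTotalOrder = record
    { isStrictTotalOrder = <⁺-isStrictTotalOrder A._≺_
        (StrictTotalOrder.isStrictTotalOrder A.strictTotalOrder) }
  ; wellFounded = λ { [ a ] → below (A.wellFounded a)
                    ; ⊤⁺    → acc λ { [ a ]<⊤⁺ → below (A.wellFounded a) } }
  ; countable   = record { to = to ; cong = to-cong ; injective = to-injective }
  }
  where
  module A = CountableWellOrder A

  below : ∀ {a} → Acc A._≺_ a → Acc (Lt⁺ A._≺_) [ a ]
  below (acc rec) = acc λ { [ b≺a ]< → below (rec b≺a) }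

  to : Carrier A ⁺ → ℕ
  to ⊤⁺    = 0
  to [ a ] = suc (index A a)

  to-cong : ∀ {x y} → Eq⁺ A._≈_ x y → to x ≡ to y
  to-cong ⊤⁺≈⊤⁺   = refl
  to-cong [ a≈b ]≈ = cong suc (Injection.cong A.countable a≈b)

  to-injective : ∀ {x y} → to x ≡ to y → Eq⁺ A._≈_ x y
  to-injective {⊤⁺}    {⊤⁺}    _  = ⊤⁺≈⊤⁺
  to-injective {[ a ]} {[ b ]} eq = [ Injection.injective A.countable (ℕ.suc-injective eq) ]≈

-- The ordinal A + n.
_+ₒ_ : CountableWellOrder → ℕ → CountableWellOrder
A +ₒ zero  = A
A +ₒ suc n = sucₒ (A +ₒ n)

-- The ordered sum A 0 + A 1 + A 2 + ….
module Sum (A : ℕ → CountableWellOrder) where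
  private
    module A i = CountableWellOrder (A i)

  Elem : Set
  Elem = ∃ λ i → Carrier (A i)

  data _≈Σ_ : Rel Elem 0ℓ where
    same : ∀ {i a b} → A._≈_ i a b → (i , a) ≈Σ (i , b)

  data _≺Σ_ : Rel Elem 0ℓ where
    earlier : ∀ {i j a b} → i < j → (i , a) ≺Σ (j , b)
    within  : ∀ {i a b} → A._≺_ i a b → (i , a) ≺Σ (i , b)

  private
    compareΣ : Trichotomous _≈Σ_ _≺Σ_
    compareΣ (i , a) (j , b) with ℕ.<-cmp i j
    ... | tri< i<j i≢j i≯j = tri< (earlier i<j) (λ { (same _) → i≢j refl })
                               λ { (earlier j<i) → i≯j j<i ; (within _) → i≢j refl }
    ... | tri> i≮j i≢j i>j = tri> (λ { (earlier i<j) → i≮j i<j ; (within _) → i≢j refl })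
                               (λ { (same _) → i≢j refl }) (earlier i>j)
    ... | tri≈ i≮i refl _ with StrictTotalOrder.compare (A.strictTotalOrder i) a b
    ...   | tri< a≺b a≉b a⊁b = tri< (within a≺b) (λ { (same e) → a≉b e })
                                 λ { (earlier i<i) → i≮i i<i ; (within l) → a⊁b l }
    ...   | tri≈ a⊀b a≈b a⊁b = tri≈ (λ { (earlier i<i) → i≮i i<i ; (within l) → a⊀b l })
                                 (same a≈b)
                                 λ { (earlier i<i) → i≮i i<i ; (within l) → a⊁b l }
    ...   | tri> a⊀b a≉b a≻b = tri> (λ { (earlier i<i) → i≮i i<i ; (within l) → a⊀b l })
                                 (λ { (same e) → a≉b e }) (within a≻b)

    isStrictTotalOrderΣ : IsStrictTotalOrder _≈Σ_ _≺Σ_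
    isStrictTotalOrderΣ = record
      { isStrictPartialOrder = record
        { isEquivalence = record
          { refl  = λ {x} → same (A.Eq.refl (proj₁ x))
          ; sym   = λ { {i , _} (same e) → same (A.Eq.sym i e) }
          ; trans = λ { {i , _} (same e) (same e′) → same (A.Eq.trans i e e′) }
          }
        ; irrefl   = λ { (same _) (earlier i<i) → ℕ.<-irrefl refl i<i
                       ; {i , _} (same e) (within l) →
                           StrictTotalOrder.irrefl (A.strictTotalOrder i) e l }
        ; trans    = λ { (earlier p) (earlier q) → earlier (ℕ.<-trans p q)
                       ; (earlier p) (within _)  → earlier p
                       ; (within _)  (earlier q) → earlier q
                       ; {i , _} (within l) (within l′) → within
                           (≺-trans (A i) l l′) }
        ; <-resp-≈ =
            (λ { (same _) (earlier p) → earlier p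
               ; {i , _} (same e) (within l) → within (proj₁ (A.≺-resp-≈ i) e l) }) ,
            (λ { (same _) (earlier p) → earlier p
               ; {i , _} (same e) (within l) → within (proj₂ (A.≺-resp-≈ i) e l) })
        }
      ; compare = compareΣ
      }

    wellFoundedΣ : WellFounded _≺Σ_
    wellFoundedΣ (i , a) = acc (below (ℕ.<-wellFounded i) (A.wellFounded i a))
      where
      below : ∀ {i} → Acc _<_ i → ∀ {a} → Acc (A._≺_ i) a →
              ∀ {x} → x ≺Σ (i , a) → Acc _≺Σ_ x
      below (acc r) _       (earlier j<i) = acc (below (r j<i) (A.wellFounded _ _))
      below i↓      (acc s) (within b≺a)  = acc (below i↓ (s b≺a))

    to : Elem → ℕ
    to (i , a) = pair i (index (A i) a)

    to-injective : ∀ {x y} → to x ≡ to y → x ≈Σ y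
    to-injective eq = uncurry both (pair-injective eq)
      where
      both : ∀ {i j a b} → i ≡ j → index (A i) a ≡ index (A j) b → (i , a) ≈Σ (j , b)
      both {i} refl eq′ = same (Injection.injective (A.countable i) eq′)

  Σₒ : CountableWellOrder
  Σₒ = record
    { strictTotalOrder = record { isStrictTotalOrder = isStrictTotalOrderΣ }
    ; wellFounded      = wellFoundedΣ
    ; countable        = record
      { to        = to
      ; cong      = λ { {i , _} (same e) → cong (pair i) (Injection.cong (A.countable i) e) }
      ; injective = to-injective
      }
    }

open Sum using (Σₒ; same; earlier; within)

-- The relation on ℕ into which the enumeration of A carries its order.  Numbers
-- of no element are related to nothing.
Coded : (A : CountableWellOrder) → Rel ℕ 0ℓ
Coded A m n = ∃ λ a → ∃ λ b → index A a ≡ m × index A b ≡ n × a ≺ b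
  where open CountableWellOrder A

module _ (A : CountableWellOrder) where
  open CountableWellOrder A hiding (Carrier)

  Coded-intro : ∀ {a b} → a ≺ b → Coded A (index A a) (index A b)
  Coded-intro a≺b = _ , _ , refl , refl , a≺b

  Coded-wellFounded : WellFounded (Coded A)
  Coded-wellFounded n = acc λ { (a , _ , refl , _) → at (wellFounded a) }
    where
    at : ∀ {a} → Acc _≺_ a → Acc (Coded A) (index A a)
    at (acc rec) = acc λ { (b , a′ , refl , eq , b≺a′) →
      at (rec (proj₁ ≺-resp-≈ (Injection.injective countable eq) b≺a′)) }

-- Isomorphism types

NoMaximum : CountableWellOrder → Set
NoMaximum A = ∀ a → ∃ λ b → CountableWellOrder._≺_ A a b

NoMaximum-resp : ∀ {A B} → A ≅ B → NoMaximum A → NoMaximum B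
NoMaximum-resp {A} {B} (h , iso) unbounded b =
  let a , ha≈b = H.surjective b
      a′ , a≺a′ = unbounded a
  in h a′ , proj₂ B.≺-resp-≈ (ha≈b A.Eq.refl) (H.mono a≺a′)
  where
  module A = CountableWellOrder A
  module B = CountableWellOrder B
  module H = IsOrderIsomorphism iso

≅-trans : ∀ {A B C} → A ≅ B → B ≅ C → A ≅ C
≅-trans {A} {B} {C} = Setoid.trans ω₁ {A} {B} {C}

sucₒ-cancel : ∀ {A B} → sucₒ A ≅ sucₒ B → A ≅ B
sucₒ-cancel {A} {B} (h , iso) = g , record
  { isOrderMonomorphism = record
    { isOrderHomomorphism = record
      { cong = λ {a} {b} a≈b →
          [≈]-injective B._≈_ (subst₂ (Eq⁺ B._≈_) (h-g a) (h-g b) (H.cong [ a≈b ]≈))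
      ; mono = λ {a} {b} a≺b →
          [<]-injective B._≺_ (subst₂ (Lt⁺ B._≺_) (h-g a) (h-g b) (H.mono [ a≺b ]<))
      }
    ; injective = λ {a} {b} e → [≈]-injective A._≈_
        (H.injective (subst₂ (Eq⁺ B._≈_) (sym (h-g a)) (sym (h-g b)) [ e ]≈))
    ; cancel    = λ {a} {b} l → [<]-injective A._≺_
        (H.cancel (subst₂ (Lt⁺ B._≺_) (sym (h-g a)) (sym (h-g b)) [ l ]<))
    }
  ; surjective = surj
  }
  where
  module A = CountableWellOrder A
  module B = CountableWellOrder B
  module H = IsOrderIsomorphism iso

  not-top : ∀ {x y} → Lt⁺ B._≺_ x y → ∃ λ b → x ≡ [ b ]
  not-top [ _ ]<    = _ , refl
  not-top [ _ ]<⊤⁺ = _ , refl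

  g : Carrier A → Carrier B
  g a = proj₁ (not-top (H.mono [ a ]<⊤⁺))

  h-g : ∀ a → h [ a ] ≡ [ g a ]
  h-g a = proj₂ (not-top (H.mono [ a ]<⊤⁺))

  h⊤≡⊤ : h ⊤⁺ ≡ ⊤⁺
  h⊤≡⊤ with H.surjective ⊤⁺
  ... | [ a ] , eq with subst (λ x → Eq⁺ B._≈_ x ⊤⁺) (h-g a) (eq [ A.Eq.refl ]≈)
  ...   | ()
  h⊤≡⊤ | ⊤⁺ , eq with h ⊤⁺ | eq ⊤⁺≈⊤⁺
  ...   | ⊤⁺ | _ = refl

  surj : ∀ b → ∃ λ a → ∀ {a′} → a′ A.≈ a → g a′ B.≈ b
  surj b with H.surjective [ b ]
  ... | [ a ] , eq = a , λ {a′} a′≈a →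
        [≈]-injective B._≈_ (subst (λ x → Eq⁺ B._≈_ x [ b ]) (h-g a′) (eq [ a′≈a ]≈))
  ... | ⊤⁺ , eq with subst (λ x → Eq⁺ B._≈_ x [ b ]) h⊤≡⊤ (eq ⊤⁺≈⊤⁺)
  ...   | ()

-- A decomposition of an order type into one without maximum followed by a
-- finite one is unique.
+ₒ-unique : ∀ {A B} → NoMaximum A → NoMaximum B → ∀ m n →
            (A +ₒ m) ≅ (B +ₒ n) → A ≅ B × m ≡ n
+ₒ-unique ua ub zero    zero    iso = iso , refl
+ₒ-unique {A} {B} ua ub zero (suc n) iso
  with NoMaximum-resp {A} {B +ₒ suc n} iso ua ⊤⁺
... | _ , ()
+ₒ-unique {A} {B} ua ub (suc m) zero iso
  with NoMaximum-resp {B} {A +ₒ suc m} (≅-sym {A +ₒ suc m} {B} iso) ub ⊤⁺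
... | _ , ()
+ₒ-unique {A} {B} ua ub (suc m) (suc n) iso =
  let iso′ , m≡n = +ₒ-unique ua ub m n (sucₒ-cancel {A +ₒ m} {B +ₒ n} iso)
  in iso′ , cong suc m≡n

-- Excluded middle and extensionality select one element from each class of an
-- inhabited setoid: the class of x, as a Boolean function, depends only on the
-- class, and so does the element that excluded middle exhibits in it.
module Representatives
  (em : ExcludedMiddle (lsuc 0ℓ)) (ext : Extensionality (lsuc 0ℓ) (lsuc 0ℓ))
  (X : Setoid (lsuc 0ℓ) 0ℓ) (default : Setoid.Carrier X) where

  private
    module X = Setoid X

    _≈?_ : ∀ x y → Dec (x X.≈ y)
    x ≈? y = map′ lower lift em

    class : X.Carrier → X.Carrier → Bool
    class x y = does (x ≈? y)

    Member : (X.Carrier → Bool) → Set (lsuc 0ℓ)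
    Member c = ∃ λ y → c y ≡ true

    pick : ∀ {c} → Dec (Member c) → X.Carrier
    pick (yes (y , _)) = y
    pick (no  _)       = default

  rep : X.Carrier → X.Carrier
  rep x = pick (em {Member (class x)})

  rep-≈ : ∀ x → x X.≈ rep x
  rep-≈ x with em {Member (class x)}
  ... | no  ∄       = ⊥-elim (∄ (x , dec-true (x ≈? x) X.refl))
  ... | yes (y , eq) = toWitness (Equivalence.from T-≡ (trans (isYes≗does (x ≈? y)) eq))

  rep-cong : ∀ {x y} → x X.≈ y → rep x ≡ rep y
  rep-cong {x} {y} x≈y = cong (λ c → pick (em {Member c}))
    (lower-extensionality (lsuc 0ℓ) (lsuc 0ℓ) ext λ z →
      does-⇔ (mk⇔ (X.trans (X.sym x≈y)) (X.trans x≈y)) (x ≈? z) (y ≈? z))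

-- Sets of finite sequences

-- Closure under initial segments.
PrefixClosed : Pred (List ℕ) 0ℓ → Set
PrefixClosed T = ∀ s t → T (s ++ t) → T s

-- Finite sequences, each a proper prefix of the next, converge to an infinite one.
module Limit (seg tail : ℕ → List ℕ)
             (seg-suc : ∀ n → seg (suc n) ≡ seg n ++ tail n)
             (tail>0 : ∀ n → 0 < length (tail n)) where
  private
    nth : List ℕ → ℕ → ℕ
    nth []      _       = 0
    nth (k ∷ _) zero    = k
    nth (_ ∷ s) (suc i) = nth s i

    nth-↾ : ∀ s → nth s ↾ length s ≡ s
    nth-↾ []      = refl
    nth-↾ (k ∷ s) = cong (k ∷_) (nth-↾ s)

    nth-++ : ∀ s t i → i < length s → nth (s ++ t) i ≡ nth s i
    nth-++ (k ∷ s) t zero    _         = refl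
    nth-++ (k ∷ s) t (suc i) (s≤s i<n) = nth-++ s t i i<n

    length-seg : ∀ n → length (seg (suc n)) ≡ length (seg n) + length (tail n)
    length-seg n = trans (cong length (seg-suc n)) (length-++ (seg n))

  n≤length-seg : ∀ n → n ≤ length (seg n)
  n≤length-seg zero    = z≤n
  n≤length-seg (suc n) = subst (suc n ≤_) (sym (length-seg n))
    (subst (_≤ length (seg n) + length (tail n)) (ℕ.+-comm n 1)
      (ℕ.+-mono-≤ (n≤length-seg n) (tail>0 n)))

  private
    -- Entries once defined do not change.
    stable : ∀ d m i → i < length (seg m) → nth (seg (d + m)) i ≡ nth (seg m) i
    stable zero    m i _   = refl
    stable (suc d) m i i<n =
      trans (cong (λ s → nth s i) (seg-suc (d + m)))
        (trans (nth-++ (seg (d + m)) _ i (grow d)) (stable d m i i<n))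
      where
      grow : ∀ d → i < length (seg (d + m))
      grow zero    = i<n
      grow (suc d) = subst (i <_) (sym (length-seg (d + m)))
        (ℕ.<-≤-trans (grow d) (ℕ.m≤m+n _ _))

  limit : ℕ → ℕ
  limit i = nth (seg (suc i)) i

  limit-↾ : ∀ n → limit ↾ length (seg n) ≡ seg n
  limit-↾ n = trans (↾-cong (length (seg n)) entry) (nth-↾ (seg n))
    where
    entry : ∀ i → i < length (seg n) → limit i ≡ nth (seg n) i
    entry i i<n with ℕ.≤-total (suc i) n
    ... | inj₁ i<n′ = sym (subst (λ m → nth (seg m) i ≡ limit i) (ℕ.m∸n+n≡m i<n′)
                        (stable (n ∸ suc i) (suc i) i (n≤length-seg (suc i))))
    ... | inj₂ n≤i = subst (λ m → nth (seg m) i ≡ nth (seg n) i) (ℕ.m∸n+n≡m n≤i)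
                        (stable (suc i ∸ n) n i i<n)

-- The derivative of a tree

-- Letters are natural numbers, each of which shows a bit; a branch u of a tree
-- shows the point label ∘ u of 2^ω.
module Derivative (em : ExcludedMiddle 0ℓ) (label : ℕ → Bool) where
  open Projective em

  -- Two sequences of the same length that show different bits.
  Diverge : Rel (List ℕ) 0ℓ
  Diverge u v = length u ≡ length v × map label u ≢ map label v

  Diverge>0 : ∀ {u v} → Diverge u v → 0 < length u × 0 < length v
  Diverge>0 {[]}    {[]}    (_ , ≢) = ⊥-elim (≢ refl)
  Diverge>0 {_ ∷ _} {_ ∷ _} _       = z<s , z<s

  -- P is thought of as a set of removed nodes: the extensions of s that are left
  -- never diverge beyond s.
  Isolated : Pred (List ℕ) 0ℓ → Pred (List ℕ) 0ℓ
  Isolated P s = ∀ u v → Diverge u v → P (s ++ u) ⊎ P (s ++ v)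

  -- Removed _◁_ T e s says that s is not in the stage e of the iteration, along _◁_
  -- and starting from T, of the derivative which keeps the nodes with two diverging
  -- extensions.  It is the complement of a stage that is defined here, because the
  -- recursion of the complement is positive.
  data Removed {I : Set} (_◁_ : Rel I 0ℓ) (T : Pred (List ℕ) 0ℓ) (e : I) (s : List ℕ) : Set where
    absent  : ¬ T s → Removed _◁_ T e s
    derived : ∀ {d} → d ◁ e → Isolated (Removed _◁_ T d) s → Removed _◁_ T e s

  Removed-↑ : ∀ {I} {_◁_ : Rel I 0ℓ} {T} → Transitive _◁_ →
              ∀ {d e s} → d ◁ e → Removed _◁_ T d s → Removed _◁_ T e s
  Removed-↑ tr d◁e (absent s∉T)    = absent s∉T
  Removed-↑ tr d◁e (derived c◁d i) = derived (tr c◁d d◁e) i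

  -- For an order homomorphism φ of the indices, the stage φ e is contained in the
  -- stage e.
  Removed-index : ∀ {I J} {_◁_ : Rel I 0ℓ} {_◀_ : Rel J 0ℓ} {T} (φ : I → J) →
                  (∀ {a b} → a ◁ b → φ a ◀ φ b) →
                  ∀ {e s} → Removed _◁_ T e s → Removed _◀_ T (φ e) s
  Removed-index φ hom (absent s∉T)    = absent s∉T
  Removed-index φ hom (derived d◁e i) = derived (hom d◁e) λ u v dv →
    removed (i u v dv)
    where
    removed : ∀ {d s t} → Removed _ _ d s ⊎ Removed _ _ d t →
              Removed _ _ (φ d) s ⊎ Removed _ _ (φ d) t
    removed (inj₁ r) = inj₁ (Removed-index φ hom r)
    removed (inj₂ r) = inj₂ (Removed-index φ hom r)

  -- A letterwise map preserving labels and sending T into T′ sends each stage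
  -- of T into the same stage of T′.
  Removed-tree : ∀ {I} {_◁_ : Rel I 0ℓ} {T T′} (ψ : ℕ → ℕ) →
                 (∀ k → label (ψ k) ≡ label k) → (∀ s → T s → T′ (map ψ s)) →
                 ∀ {e} s {s′} → s′ ≡ map ψ s → Removed _◁_ T′ e s′ → Removed _◁_ T e s
  Removed-tree ψ lab hom s refl (absent ∉T′)     = absent (∉T′ ∘ hom s)
  Removed-tree {_◁_ = _◁_} {T} {T′} ψ lab hom s refl (derived d◁e i) =
    derived d◁e λ u v (len , dv) → removed u v (i (map ψ u) (map ψ v)
      ( trans (length-map ψ u) (trans len (sym (length-map ψ v)))
      , λ eq → dv (trans (sym (labels u)) (trans eq (labels v)))))
    where
    labels : ∀ u → map label (map ψ u) ≡ map label u
    labels u = trans (sym (map-∘ u)) (map-cong lab u)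

    removed : ∀ {d} u v →
              Removed _◁_ T′ d (map ψ s ++ map ψ u) ⊎ Removed _◁_ T′ d (map ψ s ++ map ψ v) →
              Removed _◁_ T d (s ++ u) ⊎ Removed _◁_ T d (s ++ v)
    removed u v (inj₁ r) = inj₁ (Removed-tree ψ lab hom (s ++ u) (sym (map-++ ψ s u)) r)
    removed u v (inj₂ r) = inj₂ (Removed-tree ψ lab hom (s ++ v) (sym (map-++ ψ s v)) r)

  -- A branch of T with a node that is removed at some stage survives up to a last
  -- stage d, and one of its nodes is then isolated.
  last-stage : ∀ {I} {_◁_ : Rel I 0ℓ} {T} {u : ℕ → ℕ} → (∀ n → T (u ↾ n)) →
               ∀ {e} → Acc _◁_ e → ∀ n → Removed _◁_ T e (u ↾ n) →
               ∃ λ d → ∃ λ m → (∀ k → ¬ Removed _◁_ T d (u ↾ k)) ×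
                               Isolated (Removed _◁_ T d) (u ↾ m)
  last-stage u∈T _ n (absent ∉T) = ⊥-elim (∉T (u∈T n))
  last-stage {_◁_ = _◁_} {T} {u} u∈T (acc rec) n (derived {d} d◁e i)
    with em {∃ λ k → Removed _◁_ T d (u ↾ k)}
  ... | yes (k , r) = last-stage u∈T (rec d◁e) k r
  ... | no  survive = d , n , (λ k r → survive (k , r)) , i

  -- The surviving branches through an isolated node all show the same point.
  isolated-unique : ∀ {P s u v} → Isolated P s →
                    u ↾ length s ≡ s → v ↾ length s ≡ s →
                    (∀ n → ¬ P (u ↾ n)) → (∀ n → ¬ P (v ↾ n)) →
                    ∀ i → label (u i) ≡ label (v i)
  isolated-unique {P} {s} {u} {v} iso u⊐s v⊐s u∉P v∉P i =
    dne λ ≢ → [ u∉P (N + suc i) ∘ subst P (sym (split u⊐s))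
              , v∉P (N + suc i) ∘ subst P (sym (split v⊐s)) ]′
      (iso (rest u) (rest v)
        ( trans (length-rest u) (sym (length-rest v))
        , λ eq → ≢ (↾-injective {u = label ∘ u} {label ∘ v} (N + suc i)
            (trans (sym (shown u⊐s)) (trans (cong (map label s ++_) eq) (shown v⊐s)))
            i (ℕ.m≤n+m (suc i) N))))
    where
    N = length s

    rest : Baire → List ℕ
    rest w = (λ j → w (N + j)) ↾ suc i

    length-rest : ∀ w → length (rest w) ≡ suc i
    length-rest w = length-applyUpTo (λ j → w (N + j)) (suc i)

    split : ∀ {w} → w ↾ N ≡ s → w ↾ (N + suc i) ≡ s ++ rest w
    split {w} eq = trans (↾-+ w N (suc i)) (cong (_++ rest w) eq)

    shown : ∀ {w} → w ↾ N ≡ s → map label s ++ map label (rest w) ≡ (label ∘ w) ↾ (N + suc i)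
    shown {w} eq = trans (sym (map-++ label s (rest w)))
      (trans (cong (map label) (sym (split eq))) (map-applyUpTo w label (N + suc i)))

  -- The nodes which the iterated derivative removes at some stage, described
  -- inductively without mention of the stages.
  data Eliminable (T : Pred (List ℕ) 0ℓ) (s : List ℕ) : Set where
    absent  : ¬ T s → Eliminable T s
    derived : Isolated (Eliminable T) s → Eliminable T s

  -- Countably many steps of the derivative suffice to remove a node: the orders
  -- obtained for the countably many pairs of extensions are summed, and two further
  -- elements are added, the first for a stage contained in all those obtained, the
  -- second for its derivative.
  Eliminable⇒Removed : ∀ {T s} → Eliminable T s →
    ∃ λ A → ∃ λ e → Removed (CountableWellOrder._≺_ A) T e s
  Eliminable⇒Removed (absent s∉T) = finₒ 1 , fzero , absent s∉T
  Eliminable⇒Removed {T} {s} (derived i) =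
    sucₒ (sucₒ S.Σₒ) , ⊤⁺ , derived [ ⊤⁺ ]<⊤⁺ λ u v dv → removed u v dv
    where
    PairStage : List ℕ × List ℕ → Set₁
    PairStage (u , v) = ∃ λ A → ∃ λ e → Diverge u v →
      Removed (CountableWellOrder._≺_ A) T e (s ++ u) ⊎
      Removed (CountableWellOrder._≺_ A) T e (s ++ v)

    choose : ∀ {u v} → Eliminable T (s ++ u) ⊎ Eliminable T (s ++ v) → PairStage (u , v)
    choose (inj₁ r) = let A , e , r′ = Eliminable⇒Removed r in A , e , λ _ → inj₁ r′
    choose (inj₂ r) = let A , e , r′ = Eliminable⇒Removed r in A , e , λ _ → inj₂ r′

    stage : ∀ {u v} → Dec (Diverge u v) → PairStage (u , v)
    stage (yes dv) = choose (i _ _ dv)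
    stage (no ¬dv) = finₒ 1 , fzero , λ dv → ⊥-elim (¬dv dv)

    open Enumeration (×-countable List-countable List-countable)

    at : ∀ n → PairStage (decode n)
    at n = stage em

    module S = Sum (λ n → proj₁ (at n))

    Δ = sucₒ (sucₒ S.Σₒ)

    removed : ∀ u v → Diverge u v →
              Removed (CountableWellOrder._≺_ Δ) T [ ⊤⁺ ] (s ++ u) ⊎
              Removed (CountableWellOrder._≺_ Δ) T [ ⊤⁺ ] (s ++ v)
    removed u v dv = subst Goal (decode-code (u , v)) goal dv
      where
      n = code (u , v)

      Goal : List ℕ × List ℕ → Set
      Goal (u , v) = Diverge u v →
        Removed (CountableWellOrder._≺_ Δ) T [ ⊤⁺ ] (s ++ u) ⊎
        Removed (CountableWellOrder._≺_ Δ) T [ ⊤⁺ ] (s ++ v)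

      raise : ∀ {t} →
              Removed (CountableWellOrder._≺_ (proj₁ (at n))) T (proj₁ (proj₂ (at n))) t →
              Removed (CountableWellOrder._≺_ Δ) T [ ⊤⁺ ] t
      raise r = Removed-↑ (λ {x} {y} {z} → ≺-trans Δ {x} {y} {z})
                 [ [ _ ]<⊤⁺ ]<
                 (Removed-index (λ a → [ [ n , a ] ]) (λ l → [ [ within l ]< ]<) r)

      goal : Goal (decode n)
      goal dv′ = ⊎-map raise raise (proj₂ (proj₂ (at n)) dv′)

  -- If the root is never removed, then T has a perfect set of branches, which is
  -- the image of 2^ω under branch; distinct arguments give branches that show distinct
  -- points.
  module Kernel {T : Pred (List ℕ) 0ℓ} (closed : PrefixClosed T)
                (root : ¬ Eliminable T []) where

    -- The nodes that are never removed.
    Node : Set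
    Node = ∃ λ s → ¬ Eliminable T s

    private
      splits : (k : Node) → ∃ λ u → ∃ λ v → Diverge u v ×
               ¬ Eliminable T (proj₁ k ++ u) × ¬ Eliminable T (proj₁ k ++ v)
      splits (s , ¬e) = dne λ ∄ → ¬e (derived λ u v dv → dne λ ¬ee →
        ∄ (u , v , dv , ¬ee ∘ inj₁ , ¬ee ∘ inj₂))

      side : Node → Bool → List ℕ
      side k false = proj₁ (splits k)
      side k true  = proj₁ (proj₂ (splits k))

      child : Node → Bool → Node
      child k b = proj₁ k ++ side k b , kept b
        where
        kept : ∀ b → ¬ Eliminable T (proj₁ k ++ side k b)
        kept false = proj₁ (proj₂ (proj₂ (proj₂ (splits k))))
        kept true  = proj₂ (proj₂ (proj₂ (proj₂ (splits k))))

      side>0 : ∀ k b → 0 < length (side k b)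
      side>0 k false = proj₁ (Diverge>0 (proj₁ (proj₂ (proj₂ (splits k)))))
      side>0 k true  = proj₂ (Diverge>0 (proj₁ (proj₂ (proj₂ (splits k)))))

      -- From the root, take one of two diverging extensions as β tells.
      path : Cantor → ℕ → Node
      path β zero    = [] , root
      path β (suc n) = child (path β n) (β n)

      module Lim β = Limit (λ n → proj₁ (path β n)) (λ n → side (path β n) (β n))
                           (λ n → refl) (λ n → side>0 (path β n) (β n))

    branch : Cantor → Baire
    branch β = Lim.limit β

    private
      node∈T : (k : Node) → T (proj₁ k)
      node∈T (s , ¬e) = dne (¬e ∘ absent)

    branch∈T : ∀ β n → T (branch β ↾ n)
    branch∈T β n = closed (branch β ↾ n) _ (subst T
      (trans (sym (Lim.limit-↾ β n))
        (trans (cong (branch β ↾_) (sym (ℕ.m+[n∸m]≡n (Lim.n≤length-seg β n))))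
          (↾-+ (branch β) n _)))
      (node∈T (path β n)))

    private
      separated : ∀ k b b′ {w w′ : Baire} →
                  w  ↾ length (proj₁ k ++ side k b ) ≡ proj₁ k ++ side k b →
                  w′ ↾ length (proj₁ k ++ side k b′) ≡ proj₁ k ++ side k b′ →
                  (∀ i → label (w i) ≡ label (w′ i)) → length (side k b) ≡ length (side k b′) →
                  map label (side k b) ≡ map label (side k b′)
      separated k b b′ {w} {w′} eq eq′ lab len =
        ++-cancelˡ (map label (proj₁ k)) (map label (side k b)) (map label (side k b′)) (begin
          map label s ++ map label (side k b)      ≡⟨ sym (map-++ label s _) ⟩
          map label (s ++ side k b)                ≡⟨ cong (map label) (sym eq) ⟩
          map label (w ↾ length (s ++ side k b))   ≡⟨ map-applyUpTo w label _ ⟩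
          (label ∘ w) ↾ length (s ++ side k b)     ≡⟨ ↾-cong _ (λ i _ → lab i) ⟩
          (label ∘ w′) ↾ length (s ++ side k b)    ≡⟨ cong ((label ∘ w′) ↾_) lengths ⟩
          (label ∘ w′) ↾ length (s ++ side k b′)   ≡⟨ sym (map-applyUpTo w′ label _) ⟩
          map label (w′ ↾ length (s ++ side k b′)) ≡⟨ cong (map label) eq′ ⟩
          map label (s ++ side k b′)               ≡⟨ map-++ label s _ ⟩
          map label s ++ map label (side k b′)     ∎)
        where
        open ≡-Reasoning
        s = proj₁ k

        lengths : length (s ++ side k b) ≡ length (s ++ side k b′)
        lengths = trans (length-++ s) (trans (cong (length s +_) len) (sym (length-++ s)))

      same-bit : ∀ k b b′ {w w′ : Baire} →
                 w  ↾ length (proj₁ k ++ side k b ) ≡ proj₁ k ++ side k b →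
                 w′ ↾ length (proj₁ k ++ side k b′) ≡ proj₁ k ++ side k b′ →
                 (∀ i → label (w i) ≡ label (w′ i)) → b ≡ b′
      same-bit k false false _  _   _   = refl
      same-bit k true  true  _  _   _   = refl
      same-bit k false true  eq eq′ lab =
        let len , ≢ = proj₁ (proj₂ (proj₂ (splits k)))
        in ⊥-elim (≢ (separated k false true eq eq′ lab len))
      same-bit k true  false eq eq′ lab =
        let len , ≢ = proj₁ (proj₂ (proj₂ (splits k)))
        in ⊥-elim (≢ (sym (separated k true false eq eq′ lab (sym len))))

    branch-injective : ∀ β β′ → (∀ i → label (branch β i) ≡ label (branch β′ i)) →
                       ∀ n → β n ≡ β′ n
    branch-injective β β′ lab n = bit (same-path n)
      where
      bit : ∀ {n} → path β n ≡ path β′ n → β n ≡ β′ n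
      bit {n} eq = same-bit (path β n) (β n) (β′ n)
        (Lim.limit-↾ β (suc n))
        (subst (λ k → branch β′ ↾ length (proj₁ k ++ side k (β′ n)) ≡ proj₁ k ++ side k (β′ n))
          (sym eq) (Lim.limit-↾ β′ (suc n)))
        lab

      same-path : ∀ n → path β n ≡ path β′ n
      same-path zero    = refl
      same-path (suc n) = cong₂ child (same-path n) (bit (same-path n))

  -- Cantor's theorem.
  Cantor-uncountable : (c : Cantor → ℕ) →
                       ¬ (∀ β β′ → c β ≡ c β′ → ∀ n → β n ≡ β′ n)
  Cantor-uncountable c inj = flipped em refl
    where
    flip : ∀ {n} → Dec (∃ λ β → c β ≡ n) → Bool
    flip {n} (yes (β , _)) = not (β n)
    flip     (no  _)       = false

    diag : Cantor
    diag n = flip (em {∃ λ β → c β ≡ n})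

    flipped : (d : Dec (∃ λ β → c β ≡ c diag)) → flip d ≡ diag (c diag) → ⊥
    flipped (no ∄)         _  = ∄ (diag , refl)
    flipped (yes (β , eq)) eq′ =
      not-¬ refl (trans (inj β diag eq (c diag)) (sym eq′))

  -- If the branches of T show only countably many points, then the iterated
  -- derivative exhausts T.
  countable⇒Eliminable : ∀ {T} → PrefixClosed T → (c : Cantor → ℕ) →
    (∀ {u v} → (∀ n → T (u ↾ n)) → (∀ n → T (v ↾ n)) →
      c (label ∘ u) ≡ c (label ∘ v) → ∀ i → label (u i) ≡ label (v i)) →
    Eliminable T []
  countable⇒Eliminable {T} closed c inj = dne λ root →
    let open Kernel closed root in
    Cantor-uncountable (λ β → c (label ∘ branch β)) λ β β′ eq →
      branch-injective β β′ (inj (branch∈T β) (branch∈T β′) eq)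

-- Ranks of well-founded trees

module Rank (em : ExcludedMiddle 0ℓ) where
  open Projective em

  -- The part of T above s is well-founded.
  data Founded (T : Pred (List ℕ) 0ℓ) (s : List ℕ) : Set where
    absent : ¬ T s → Founded T s
    node   : (∀ k → Founded T (s ∷ʳ k)) → Founded T s

  branch-free⇒Founded : ∀ {T} → ¬ (∃ λ w → ∀ n → T (w ↾ n)) → Founded T []
  branch-free⇒Founded {T} no-branch = dne λ root →
    let open Descent root in no-branch (w , λ n → subst T (seq-↾ n) (node∈T (seq n)))
    where
    Node : Set
    Node = ∃ λ s → ¬ Founded T s

    node∈T : (k : Node) → T (proj₁ k)
    node∈T (s , ¬f) = dne (¬f ∘ absent)

    module Descent (root : ¬ Founded T []) where
      letter : (k : Node) → ∃ λ m → ¬ Founded T (proj₁ k ∷ʳ m)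
      letter (s , ¬f) = ¬∀⇒∃¬ (¬f ∘ node)

      seq : ℕ → Node
      seq zero    = [] , root
      seq (suc n) = _ , proj₂ (letter (seq n))

      w : Baire
      w n = proj₁ (letter (seq n))

      seq-↾ : ∀ n → proj₁ (seq n) ≡ w ↾ n
      seq-↾ zero    = refl
      seq-↾ (suc n) = trans (cong (_∷ʳ w n) (seq-↾ n)) (applyUpTo-∷ʳ w n)

  -- A well-founded tree has a rank function into a countable well-order, the ranks
  -- above the immediate successors of s being placed one after the other and s itself
  -- on top.  The rank of s ++ t is g t.
  rank : ∀ {T s} → PrefixClosed T → Founded T s →
         ∃ λ A → ∃ λ (g : List ℕ → Carrier A) →
           ∀ t k → T (s ++ t ∷ʳ k) → CountableWellOrder._≺_ A (g (t ∷ʳ k)) (g t)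
  rank {T} {s} closed (absent s∉T) =
    finₒ 1 , (λ _ → fzero) , λ t k tr → ⊥-elim (s∉T (closed s (t ∷ʳ k) tr))
  rank {T} {s} closed (node f) = sucₒ S.Σₒ , g , descends
    where
    sub : ∀ k → ∃ λ A → ∃ λ (g : List ℕ → Carrier A) →
            ∀ t l → T ((s ∷ʳ k) ++ t ∷ʳ l) → CountableWellOrder._≺_ A (g (t ∷ʳ l)) (g t)
    sub k = rank closed (f k)

    module S = Sum (λ k → proj₁ (sub k))

    g : List ℕ → Carrier (sucₒ S.Σₒ)
    g []      = ⊤⁺
    g (k ∷ t) = [ k , proj₁ (proj₂ (sub k)) t ]

    descends : ∀ t k → T (s ++ t ∷ʳ k) → CountableWellOrder._≺_ (sucₒ S.Σₒ) (g (t ∷ʳ k)) (g t)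
    descends []      k tr = [ _ ]<⊤⁺
    descends (j ∷ t) k tr =
      [ within (proj₂ (proj₂ (sub j)) t k (subst T (sym (++-assoc s (j ∷ []) _)) tr)) ]<

-- Letters coding a bit and two natural numbers

private
  toBool : ℕ → Bool
  toBool zero    = false
  toBool (suc _) = true

  fromBool : Bool → ℕ
  fromBool false = 0
  fromBool true  = 1

  toBool-fromBool : ∀ b → toBool (fromBool b) ≡ b
  toBool-fromBool false = refl
  toBool-fromBool true  = refl

letter : Bool → ℕ → ℕ → ℕ
letter b m n = pair (fromBool b) (pair m n)

bit : ℕ → Bool
bit k = toBool (fst k)

middle last : ℕ → ℕ
middle k = fst (snd k)
last   k = snd (snd k)

bit-letter : ∀ b m n → bit (letter b m n) ≡ b
bit-letter b m n = trans (cong toBool (fst-pair _ _)) (toBool-fromBool b)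

middle-letter : ∀ b m n → middle (letter b m n) ≡ m
middle-letter b m n = trans (cong fst (snd-pair _ _)) (fst-pair m n)

last-letter : ∀ b m n → last (letter b m n) ≡ n
last-letter b m n = trans (cong snd (snd-pair _ _)) (snd-pair m n)

-- Apply σ to the last component.
relabel : (ℕ → ℕ) → ℕ → ℕ
relabel σ k = letter (bit k) (middle k) (σ (last k))

-- The pairs m ◁ n with n ◁ a; for a transitive relation, its restriction to the part
-- below a.
Below : Rel ℕ 0ℓ → ℕ → Rel ℕ 0ℓ
Below _◁_ a m n = m ◁ n × n ◁ a

Below-wellFounded : ∀ {_◁_ : Rel ℕ 0ℓ} {a} → WellFounded _◁_ → WellFounded (Below _◁_ a)
Below-wellFounded wf = Subrelation.wellFounded proj₁ wf

-- The partial functions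

-- For some z, the section of D at (x , y , z) is empty.  With D closed, these are
-- the Σ¹₂ sets of pairs.
EmptySection : Subset (((cantor ⊗ cantor) ⊗ baire) ⊗ baire) → Rel Cantor 0ℓ
EmptySection D x y = ∃ λ z → ¬ (∃ λ w → D (((x , y) , z) , w))

module Pieces (em : ExcludedMiddle 0ℓ) (ext : Extensionality 0ℓ 0ℓ)
              {D : Subset (((cantor ⊗ cantor) ⊗ baire) ⊗ baire)}
              (closed-D : Closed (((cantor ⊗ cantor) ⊗ baire) ⊗ baire) D) where
  open Projective em
  open Derivative em bit
  open Rank em
  open Enumeration List-countable

  private
    Triple : Space
    Triple = (cantor ⊗ cantor) ⊗ baire

  -- The pair (x , u), where u codes (y , z , g) letter by letter, is such that g
  -- descends along _⊲_ on the tree of the section of D at (x , y , z), a finite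
  -- sequence s having the rank g (code s).
  Ranked : Rel ℕ 0ℓ → Subset (cantor ⊗ baire)
  Ranked _⊲_ (x , u) = ∀ s k →
    Tree Triple D ((x , bit ∘ u) , middle ∘ u) (s ∷ʳ k) →
    last (u (code (s ∷ʳ k))) ⊲ last (u (code s))

  Ranked-closed : ∀ _⊲_ → Closed (cantor ⊗ baire) (Ranked _⊲_)
  Ranked-closed _⊲_ =
    Closed-⋂ (cantor ⊗ baire) λ s →
    Closed-⋂ (cantor ⊗ baire) λ k →
    Finitary⇒Closed (cantor ⊗ baire)
      (Finitary-→ (cantor ⊗ baire) (inTree (s ∷ʳ k)) (ranks (code (s ∷ʳ k)) (code s)))
    where
    inTree : ∀ t → Finitary (cantor ⊗ baire)
                   (λ (x , u) → Tree Triple D ((x , bit ∘ u) , middle ∘ u) t)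
    inTree t = let n , det = Tree-finitary Triple t in
      n , λ (x , u) (y , v) (a , b) → det _ _
        ((a , λ i i<n → cong bit (b i i<n)) , λ i i<n → cong middle (b i i<n))

    ranks : ∀ i j → Finitary (cantor ⊗ baire) (λ (x , u) → last (u i) ⊲ last (u j))
    ranks i j = suc i ⊔ suc j , λ (x , u) (y , v) (_ , b) →
      subst₂ _⊲_ (cong last (b i (ℕ.m≤m⊔n (suc i) (suc j))))
                 (cong last (b j (ℕ.m≤n⊔m (suc i) (suc j))))

  -- The tree of the section of Ranked _⊲_ at x.
  RankedTree : Rel ℕ 0ℓ → Cantor → Pred (List ℕ) 0ℓ
  RankedTree _⊲_ = Tree cantor (Ranked _⊲_)

  private
    descending : ∀ {_⊲_ : Rel ℕ 0ℓ} → WellFounded _⊲_ →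
                 (f : ℕ → ℕ) → ¬ (∀ n → f (suc n) ⊲ f n)
    descending {_⊲_} wf f desc = go (wf (f 0)) 0 refl
      where
      go : ∀ {m} → Acc _⊲_ m → ∀ n → m ≡ f n → ⊥
      go (acc rec) n refl = go (rec (desc n)) (suc n) refl

  Ranked⇒branch-free : ∀ {_⊲_} → WellFounded _⊲_ → ∀ {x u} → Ranked _⊲_ (x , u) →
                       ¬ (∃ λ w → D (((x , bit ∘ u) , middle ∘ u) , w))
  Ranked⇒branch-free {_⊲_} wf {x} {u} r (w , d) =
    descending wf (λ n → last (u (code (w ↾ n)))) λ n →
      subst (λ s → last (u (code s)) ⊲ last (u (code (w ↾ n))))
        (applyUpTo-∷ʳ w n)
        (r (w ↾ n) (w n) (subst (Tree Triple D _) (sym (applyUpTo-∷ʳ w n))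
          (branch⇒Tree Triple d (suc n))))

  branch-free⇒Ranked : ∀ {x y z} → ¬ (∃ λ w → D (((x , y) , z) , w)) →
    ∃ λ A → ∃ λ u → Ranked (Coded A) (x , u) × (∀ i → bit (u i) ≡ y i)
  branch-free⇒Ranked {x} {y} {z} no-branch =
    A , u , ranked , λ i → bit-letter (y i) (z i) _
    where
    T : Pred (List ℕ) 0ℓ
    T = Tree Triple D ((x , y) , z)

    ranking = rank {T} (Tree-++ˡ Triple) (branch-free⇒Founded λ (w , b) →
                no-branch (w , branch⇐Tree Triple closed-D b))

    A = proj₁ ranking

    g : List ℕ → Carrier A
    g = proj₁ (proj₂ ranking)

    u : Baire
    u i = letter (y i) (z i) (index A (g (decode i)))

    last-u : ∀ s → last (u (code s)) ≡ index A (g s)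
    last-u s = trans (last-letter (y _) (z _) _) (cong (index A ∘ g) (decode-code s))

    ranked : Ranked (Coded A) (x , u)
    ranked s k t = subst₂ (Coded A) (sym (last-u (s ∷ʳ k))) (sym (last-u s))
      (Coded-intro A (proj₂ (proj₂ ranking) s k
        (proj₂ (Tree-finitary Triple (s ∷ʳ k)) _ _
          ( (Agree-refl cantor , λ i _ → bit-letter (y i) (z i) _)
          , λ i _ → middle-letter (y i) (z i) _) t)))

  -- Composing the rank function with an order homomorphism.
  module _ (_⊲_ _⊲′_ : Rel ℕ 0ℓ) (σ : ℕ → ℕ) (hom : ∀ m n → m ⊲ n → σ m ⊲′ σ n) where

    Ranked-relabel : ∀ {x u} → Ranked _⊲_ (x , u) → Ranked _⊲′_ (x , relabel σ ∘ u)
    Ranked-relabel {x} {u} r s k t =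
      subst₂ _⊲′_ (sym (last-letter _ _ _)) (sym (last-letter _ _ _))
        (hom _ _ (r s k (proj₂ (Tree-finitary Triple (s ∷ʳ k)) _ _
          ( (Agree-refl cantor , λ i _ → bit-letter (bit (u i)) (middle (u i)) _)
          , λ i _ → middle-letter (bit (u i)) (middle (u i)) _) t)))

    RankedTree-relabel : ∀ {x} s → RankedTree _⊲_ x s → RankedTree _⊲′_ x (map (relabel σ) s)
    RankedTree-relabel {x} s (x′ , w , a , eq , r) =
      x′ , relabel σ ∘ w ,
      subst (λ n → Agree cantor n x x′) (sym (length-map (relabel σ) s)) a ,
      trans (cong ((relabel σ ∘ w) ↾_) (length-map (relabel σ) s))
        (trans (sym (map-applyUpTo w (relabel σ) (length s))) (cong (map (relabel σ)) eq)) ,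
      Ranked-relabel r

  module _ (_⊲_ _◁_ : Rel ℕ 0ℓ) where

    -- For a fixed node, removal at the stage e is a Borel condition on x, by induction
    -- on e: membership in the tree is clopen, and all quantifiers involved range over
    -- countable sets.
    Removed-Borel : ∀ {e} → Acc _◁_ e → ∀ s →
                    𝚫¹₁ cantor (λ x → Removed _◁_ (RankedTree _⊲_ x) e s)
    Isolated-Borel : ∀ {e} → Acc _◁_ e → ∀ s →
                     𝚫¹₁ cantor (λ x → Isolated (Removed _◁_ (RankedTree _⊲_ x) e) s)

    Removed-Borel {e} (acc rec) s = 𝚫¹₁-resp cantor
      (λ x → mk⇔ [ absent , (λ (d , d◁e , i) → derived {d = d} d◁e i) ]′
                 λ { (absent ∉T) → inj₁ ∉T ; (derived d◁e i) → inj₂ (_ , d◁e , i) })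
      (𝚫¹₁-⊎ cantor
        (𝚫¹₁-∁ cantor (Finitary⇒𝚫¹₁ cantor (Tree-finitary cantor s)))
        (𝚫¹₁-⋃ ℕ-countable cantor λ d →
         𝚫¹₁-×ˡ cantor λ d◁e → Isolated-Borel {d} (rec d◁e) s))

    Isolated-Borel e↓ s =
      𝚫¹₁-⋂ List-countable cantor λ u →
      𝚫¹₁-⋂ List-countable cantor λ v →
      𝚫¹₁-→ cantor λ _ →
      𝚫¹₁-⊎ cantor (Removed-Borel e↓ (s ++ u)) (Removed-Borel e↓ (s ++ v))

    -- The pairs (x , y) such that t is isolated at the stage e for the tree of
    -- Ranked _⊲_ at x, and y is shown by a branch through t that survives up to
    -- that stage.  The isolation of t makes y unique.
    Piece : ℕ → List ℕ → Subset (cantor ⊗ cantor)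
    Piece e t (x , y) =
      Isolated (Removed _◁_ (RankedTree _⊲_ x) e) t ×
      ∃ λ u → u ↾ length t ≡ t × (∀ i → bit (u i) ≡ y i) ×
              (∀ s → u ↾ length s ≡ s → ¬ Removed _◁_ (RankedTree _⊲_ x) e s)

    Piece-isFunction : ∀ e t → IsFunction (Piece e t)
    Piece-isFunction e t {x} (iso , u , u⊐t , uy , u∉) (_ , v , v⊐t , vz , v∉) =
      ext λ i → trans (sym (uy i)) (trans
        (isolated-unique {Removed _◁_ (RankedTree _⊲_ x) e} iso u⊐t v⊐t
          (λ n → u∉ _ (↾-length u n)) (λ n → v∉ _ (↾-length v n)) i)
        (vz i))

    Piece⊆ : WellFounded _⊲_ → ∀ e t {x y} → Piece e t (x , y) →
             EmptySection D x y
    Piece⊆ wf e t {x} {y} (_ , u , _ , uy , u∉) =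
      middle ∘ u , subst (λ y → ¬ (∃ λ w → D (((x , y) , middle ∘ u) , w))) (ext uy)
        (Ranked⇒branch-free wf (branch⇐Tree cantor (Ranked-closed _⊲_) λ n →
          dne (u∉ (u ↾ n) (↾-length u n) ∘ absent)))

    Piece-𝚺¹₁ : WellFounded _◁_ → ∀ e t → 𝚺¹₁ (cantor ⊗ cantor) (Piece e t)
    Piece-𝚺¹₁ wf e t =
      𝚺¹₁-× CC
        (𝚺¹₁-preimage CC cantor (λ n p → n , λ q → proj₁) (proj₁ (Isolated-Borel (wf e) t)))
        (𝚺¹₁-∃ CC
          (𝚺¹₁-× CCB (Closed⇒𝚺¹₁ CCB (Finitary⇒Closed CCB (through t)))
          (𝚺¹₁-× CCB (Closed⇒𝚺¹₁ CCB (Closed-⋂ CCB λ i → Finitary⇒Closed CCB (shows i)))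
          (𝚺¹₁-⋂ List-countable CCB λ s →
            𝚺¹₁-resp CCB (λ _ → mk⇔ [ (λ ¬p p → ⊥-elim (¬p p)) , (λ q _ → q) ]′ classical)
            (𝚺¹₁-⊎ CCB
              (Closed⇒𝚺¹₁ CCB (Finitary⇒Closed CCB (Finitary-∁ CCB (through s))))
              (𝚺¹₁-preimage CCB cantor (λ n p → n , λ q → proj₁ ∘ proj₁)
                (proj₂ (Removed-Borel (wf e) s))))))))
      where
      CC CCB : Space
      CC  = cantor ⊗ cantor
      CCB = CC ⊗ baire

      through : ∀ s → Finitary CCB (λ (_ , u) → u ↾ length s ≡ s)
      through s = length s , λ (_ , u) (_ , v) (_ , b) eq →
        trans (sym (↾-cong (length s) b)) eq

      shows : ∀ i → Finitary CCB (λ ((_ , y) , u) → bit (u i) ≡ y i)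
      shows i = suc i , λ ((_ , y) , u) ((_ , y′) , u′) ((_ , a) , b) eq →
        trans (cong bit (sym (b i ℕ.≤-refl))) (trans eq (a i ℕ.≤-refl))

      classical : ∀ {P Q : Set} → (P → Q) → ¬ P ⊎ Q
      classical {P} f with em {P}
      ... | yes p = inj₂ (f p)
      ... | no ¬p = inj₁ ¬p

  -- The piece given by a well-order R, the numbers a and e of two of its elements, and
  -- the code of a node; these three numbers are coded as one.  The functions Piece make
  -- sense, and are used, for all values of a and e.
  piece : CountableWellOrder → ℕ → Subset (cantor ⊗ cantor)
  piece R n = Piece (Below (Coded R) (fst n)) (Coded R) (fst (snd n)) (decode (snd (snd n)))

  piece-intro : ∀ R a e t {p} → Piece (Below (Coded R) a) (Coded R) e t p →
                piece R (pair a (pair e (code t))) p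
  piece-intro R a e t {p} =
    subst₃ (fst-pair _ _) (trans (cong fst (snd-pair _ _)) (fst-pair _ _))
      (trans (cong decode (trans (cong snd (snd-pair _ _)) (snd-pair _ _))) (decode-code t))
    where
    subst₃ : ∀ {a a′ e e′ t t′} → a′ ≡ a → e′ ≡ e → t′ ≡ t →
             Piece (Below (Coded R) a) (Coded R) e t p →
             Piece (Below (Coded R) a′) (Coded R) e′ t′ p
    subst₃ refl refl refl q = q

  piece-isFunction : ∀ R n → IsFunction (piece R n)
  piece-isFunction R n = Piece-isFunction (Below (Coded R) (fst n)) (Coded R)
    (fst (snd n)) (decode (snd (snd n)))

  piece-𝚫¹₂ : ∀ R n → 𝚫¹₂ (cantor ⊗ cantor) (piece R n)
  piece-𝚫¹₂ R n = 𝚺¹₁⊆𝚫¹₂ (cantor ⊗ cantor)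
    (Piece-𝚺¹₁ (Below (Coded R) (fst n)) (Coded R) (Coded-wellFounded R)
      (fst (snd n)) (decode (snd (snd n))))

  piece⊆ : ∀ R n {x y} → piece R n (x , y) → EmptySection D x y
  piece⊆ R n = Piece⊆ (Below (Coded R) (fst n)) (Coded R)
                 (Below-wellFounded (Coded-wellFounded R)) (fst (snd n)) (decode (snd (snd n)))

  -- The well-order A + 1 + B + 1 + 1 + ….
  module Ambient (A B : CountableWellOrder) where
    summand : ℕ → CountableWellOrder
    summand 0 = A
    summand 1 = finₒ 1
    summand 2 = B
    summand (suc (suc (suc _))) = finₒ 1

    ambient : CountableWellOrder
    ambient = Σₒ summand

    ambient-unbounded : NoMaximum ambient
    ambient-unbounded (i , _) =
      (suc (suc (suc i)) , fzero) , earlier (ℕ.m<n+m i {3} z<s)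

    module Copy {R : CountableWellOrder} (iso : ambient ≅ R) where
      private
        module A = CountableWellOrder A
        module R = CountableWellOrder R
        h = proj₁ iso
        module H = IsOrderIsomorphism (proj₂ iso)

      -- The number of the element of R dividing the copy of A from that of B.
      divider : ℕ
      divider = index R (h (1 , fzero))

      leftIndex : Carrier A → ℕ
      leftIndex a = index R (h (0 , a))

      rightIndex : Carrier B → ℕ
      rightIndex b = index R (h (2 , b))

      rightIndex-mono : ∀ {b c} → CountableWellOrder._≺_ B b c →
                        Coded R (rightIndex b) (rightIndex c)
      rightIndex-mono l = Coded-intro R (H.mono (within l))

      left-injective : ∀ a b → leftIndex a ≡ leftIndex b → a A.≈ b
      left-injective a b eq with H.injective (Injection.injective R.countable eq)
      ... | same e = e

      -- Order homomorphisms, in both directions, between the numbers of the elements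
      -- of A and the numbers of the elements of R below the divider.
      embedding : ∃ λ (ι : ℕ → ℕ) → ∀ a → ι (index A a) ≡ leftIndex a
      embedding = extend 0 (index A) leftIndex λ a b eq →
        Injection.cong R.countable (H.cong (same (Injection.injective A.countable eq)))

      embed : ℕ → ℕ
      embed = proj₁ embedding

      embed-hom : ∀ m n → Coded A m n → Below (Coded R) divider (embed m) (embed n)
      embed-hom _ _ (a , b , refl , refl , a≺b) =
        subst₂ (Below (Coded R) divider) (sym (proj₂ embedding a)) (sym (proj₂ embedding b))
          (Coded-intro R (H.mono (within a≺b)) , Coded-intro R (H.mono (earlier z<s)))

      retraction : ∃ λ (ρ : ℕ → ℕ) → ∀ a → ρ (leftIndex a) ≡ index A a
      retraction = extend 0 leftIndex (index A) λ a b eq →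
        Injection.cong A.countable (left-injective a b eq)

      retract : ℕ → ℕ
      retract = proj₁ retraction

      private
        module Amb = CountableWellOrder ambient

        pull : ∀ p → ∃ λ x → h x R.≈ p
        pull p = let x , eq = H.surjective p in x , eq Amb.Eq.refl

        left-segment : ∀ {x y} → x Amb.≺ y → y Amb.≺ (1 , fzero) →
                       ∃ λ a → ∃ λ b → x ≡ (0 , a) × y ≡ (0 , b) × a A.≺ b
        left-segment {0 , a} {0 , b} (within a≺b) _ = a , b , refl , refl , a≺b
        left-segment {_}     {_ , _} _            (within {a = fzero} ())
        left-segment {suc _ , _} {0 , _} (earlier ()) _
        left-segment {_}     {suc _ , _} _        (earlier (s≤s ()))

      retract-hom : ∀ m n → Below (Coded R) divider m n → Coded A (retract m) (retract n)
      retract-hom _ _ ((p , q , refl , refl , p≺q) , (q′ , d , q′≡q , d≡divider , q′≺d)) =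
        go (left-segment x≺y y≺d)
        where
        x = proj₁ (pull p)
        y = proj₁ (pull q)

        ≺-resp₂ : ∀ {b b′ c c′} → b R.≈ b′ → c R.≈ c′ → b R.≺ c → b′ R.≺ c′
        ≺-resp₂ e e′ l = proj₁ R.≺-resp-≈ e′ (proj₂ R.≺-resp-≈ e l)

        x≺y : x Amb.≺ y
        x≺y = H.cancel (≺-resp₂ (R.Eq.sym (proj₂ (pull p))) (R.Eq.sym (proj₂ (pull q))) p≺q)

        y≺d : y Amb.≺ (1 , fzero)
        y≺d = H.cancel (≺-resp₂
          (R.Eq.trans (Injection.injective R.countable q′≡q) (R.Eq.sym (proj₂ (pull q))))
          (Injection.injective R.countable d≡divider) q′≺d)

        retracted : ∀ {r z a} → h z R.≈ r → z ≡ (0 , a) → retract (index R r) ≡ index A a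
        retracted {a = a} e refl =
          trans (cong retract (sym (Injection.cong R.countable e))) (proj₂ retraction a)

        go : (∃ λ a → ∃ λ b → x ≡ (0 , a) × y ≡ (0 , b) × a A.≺ b) →
             Coded A (retract (index R p)) (retract (index R q))
        go (a , b , x≡a , y≡b , a≺b) =
          subst₂ (Coded A) (sym (retracted (proj₂ (pull p)) x≡a))
                 (sym (retracted (proj₂ (pull q)) y≡b)) (Coded-intro A a≺b)

  -- If the root of the tree of Ranked (Coded A) at x is removed at a stage indexed by
  -- B, then for every copy R of A + 1 + B + 1 + 1 + …, each point shown by a branch of
  -- this tree lies in a piece of R.  The two homomorphisms between A and the part of R
  -- below the divider serve to carry the branch over to the tree formed with R, and
  -- the removal of the root back to it.
  inPiece : ∀ A B {x u y c} → Ranked (Coded A) (x , u) → (∀ i → bit (u i) ≡ y i) →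
            Removed (CountableWellOrder._≺_ B) (RankedTree (Coded A) x) c [] →
            ∀ R → Ambient.ambient A B ≅ R → ∃ λ n → piece R n (x , y)
  inPiece A B {x} {u} {y} {c} ranked uy removed R iso =
    let d , m , survives , isolated =
          last-stage (branch⇒Tree cantor v∈Ranked) (Coded-wellFounded R _) 0 root-removed
    in _ , piece-intro R divider d (v ↾ m)
      (isolated , v , ↾-length v m ,
       (λ i → trans (bit-letter (bit (u i)) (middle (u i)) _) (uy i)) ,
       λ s eq → subst (λ t → ¬ Removed (Coded R) T d t) eq (survives (length s)))
    where
    open Ambient A B
    open Copy {R} iso

    T : Pred (List ℕ) 0ℓ
    T = RankedTree (Below (Coded R) divider) x

    v : Baire
    v = relabel embed ∘ u

    v∈Ranked : Ranked (Below (Coded R) divider) (x , v)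
    v∈Ranked = Ranked-relabel (Coded A) (Below (Coded R) divider) embed embed-hom ranked

    root-removed : Removed (Coded R) T (rightIndex c) []
    root-removed = Removed-tree (relabel retract)
      (λ k → bit-letter (bit k) (middle k) _)
      (RankedTree-relabel (Below (Coded R) divider) (Coded A) retract retract-hom) [] refl
      (Removed-index rightIndex rightIndex-mono removed)

  -- Suppose that every order without maximum has a copy R such that all pairs (R , n)
  -- are values of d.  Then the pieces given by the values of d cover all the countable
  -- sections of EmptySection D.
  cover : ∀ {ℓ} {I : Set ℓ} (d : I → CountableWellOrder × ℕ) →
          (∀ R₀ → NoMaximum R₀ → ∃ λ R → R₀ ≅ R × (∀ n → ∃ λ α → d α ≡ (R , n))) →
          ∀ {x y} → EmptySection D x y →
          AtMostCountable (EmptySection D x) →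
          ∃ λ α → uncurry piece (d α) (x , y)
  cover d onto {x} {y} (z , no-branch) (c , c-injective) =
    let A , u , ranked , uy = branch-free⇒Ranked no-branch
        B , e , removed = Eliminable⇒Removed (eliminable A)
        R , iso , values = onto (Ambient.ambient A B) (Ambient.ambient-unbounded A B)
        n , p = inPiece A B ranked uy removed R iso
        α , eq = values n
    in α , subst (λ q → uncurry piece q (x , y)) (sym eq) p
    where
    inSection : ∀ A {v} → (∀ n → RankedTree (Coded A) x (v ↾ n)) →
                EmptySection D x (bit ∘ v)
    inSection A b = _ , Ranked⇒branch-free (Coded-wellFounded A)
                          (branch⇐Tree cantor (Ranked-closed (Coded A)) b)

    eliminable : ∀ A → Eliminable (RankedTree (Coded A) x) []
    eliminable A = countable⇒Eliminable (Tree-++ˡ cantor) c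
      λ b b′ eq → cong-app (c-injective (inSection A b) (inSection A b′) eq)

-- A map on the order types whose values include all pairs of an order type without
-- maximum, given by its representative, and a natural number.
module Indexing (em : ExcludedMiddle (lsuc 0ℓ)) (ext : Extensionality (lsuc 0ℓ) (lsuc 0ℓ)) where

  open Representatives em ext ω₁ (finₒ 0) public

  private
    Decomposition : CountableWellOrder → Set₁
    Decomposition A = ∃ λ R → ∃ λ n → NoMaximum R × A ≅ (R +ₒ n)

    -- Order types that are not of the form R + n get an arbitrary value.
    read : ∀ A → Dec (Decomposition A) → CountableWellOrder × ℕ
    read A (yes (R , n , _)) = rep R , n
    read A (no  _)           = finₒ 0 , 0

  abstract
    decompose : CountableWellOrder → CountableWellOrder × ℕ
    decompose A = read (rep A) em

    decompose-cong : ∀ {A B} → A ≅ B → decompose A ≡ decompose B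
    decompose-cong {A} {B} A≅B = cong (λ C → read C em) (rep-cong {A} {B} A≅B)

    decompose-+ₒ : ∀ {R} n → NoMaximum R → decompose (R +ₒ n) ≡ (rep R , n)
    decompose-+ₒ {R} n unbounded = read-+ em
      where
      read-+ : (d : Dec (Decomposition (rep (R +ₒ n)))) → read (rep (R +ₒ n)) d ≡ (rep R , n)
      read-+ (no ∄) = ⊥-elim (∄ (R , n , unbounded ,
        ≅-sym {R +ₒ n} {rep (R +ₒ n)} (rep-≈ (R +ₒ n))))
      read-+ (yes (R′ , n′ , unbounded′ , iso)) =
        let R≅R′ , n≡n′ = +ₒ-unique {R} {R′} unbounded unbounded′ n n′
              (≅-trans {R +ₒ n} {rep (R +ₒ n)} {R′ +ₒ n′} (rep-≈ (R +ₒ n)) iso)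
        in cong₂ _,_ (sym (rep-cong {R} {R′} R≅R′)) (sym n≡n′)

  decompose-onto : ∀ R₀ → NoMaximum R₀ →
                   ∃ λ R → R₀ ≅ R × (∀ n → ∃ λ A → decompose A ≡ (R , n))
  decompose-onto R₀ unbounded =
    rep R₀ , rep-≈ R₀ , λ n → R₀ +ₒ n , decompose-+ₒ {R₀} n unbounded

-- The pieces for D, as a family indexed by the countable ordinals.
module Family (em₁ : ExcludedMiddle (lsuc 0ℓ)) (ext₁ : Extensionality (lsuc 0ℓ) (lsuc 0ℓ))
              {D : Subset (((cantor ⊗ cantor) ⊗ baire) ⊗ baire)}
              (closed-D : Closed (((cantor ⊗ cantor) ⊗ baire) ⊗ baire) D) where

  em : ExcludedMiddle 0ℓ
  em = map′ lower lift em₁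

  ext : Extensionality 0ℓ 0ℓ
  ext = lower-extensionality (lsuc 0ℓ) (lsuc 0ℓ) ext₁

  open Pieces em ext closed-D
  open Indexing em₁ ext₁

  member : CountableWellOrder → Subset (cantor ⊗ cantor)
  member α = uncurry piece (decompose α)

  family : Func ω₁ PairSets
  family = record
    { to   = member
    ; cong = λ {α} {β} α≅β → Setoid.reflexive PairSets
        (cong (uncurry piece) (decompose-cong {α} {β} α≅β))
    }

  member-𝚫¹₂ : ∀ α → 𝚫¹₂ (cantor ⊗ cantor) (member α)
  member-𝚫¹₂ α = uncurry piece-𝚫¹₂ (decompose α)

  member-isFunction : ∀ α → IsFunction (member α)
  member-isFunction α = uncurry piece-isFunction (decompose α)

  member⊆ : ∀ α {x y} → member α (x , y) → EmptySection D x y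
  member⊆ α = piece⊆ (proj₁ (decompose α)) (proj₂ (decompose α))

  abstract
    members-cover : ∀ {x y} → EmptySection D x y →
                    AtMostCountable (EmptySection D x) →
                    ∃ λ α → member α (x , y)
    members-cover = cover decompose decompose-onto

lemma3p4 : ExcludedMiddle (lsuc 0ℓ) →
    Extensionality (lsuc 0ℓ) (lsuc 0ℓ) →
    (G : Rel Cantor 0ℓ) →
    IsGraph G →
    LocallyCountable G →
    𝚺¹₂ (cantor ⊗ cantor) (uncurry G) →
    ∃ λ (F : Func ω₁ PairSets) →
    (∀ α → 𝚫¹₂ (cantor ⊗ cantor) (Func.to F α)) ×
    IsGeneratedBy G (Func.to F)
lemma3p4 em₁ ext₁ G isGraph loc (C , (D , closed-D , ∁C⇔D) , G⇔C) =
  F.family , F.member-𝚫¹₂ , record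
    { isFunction = F.member-isFunction
    ; dom⊆       = λ α (y , p) → y , member⊆G α p
    ; ran⊆       = λ α (x , p) → x , IsGraph.sym isGraph (member⊆G α p)
    ; generates  = λ x y _ _ → mk⇔
        (λ xGy → let α , p = covered xGy in α , inj₂ p)
        λ { (α , inj₁ p) → IsGraph.sym isGraph (member⊆G α p)
          ; (α , inj₂ p) → member⊆G α p }
    }
  where
  module F = Family em₁ ext₁ closed-D
  open Equivalence

  G⇔EmptySection : ∀ x y → G x y ⇔ EmptySection D x y
  G⇔EmptySection x y = mk⇔
    (λ xGy → let z , c = to (G⇔C (x , y)) xGy in
       z , λ b → from (∁C⇔D ((x , y) , z)) b c)
    (λ (z , ∄) → from (G⇔C (x , y))
       (z , Projective.dne F.em λ ¬c → ∄ (to (∁C⇔D ((x , y) , z)) ¬c)))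

  member⊆G : ∀ α {x y} → F.member α (x , y) → G x y
  member⊆G α {x} {y} p = from (G⇔EmptySection x y) (F.member⊆ α p)

  covered : ∀ {x y} → G x y → ∃ λ α → F.member α (x , y)
  covered {x} {y} xGy = F.members-cover (to (G⇔EmptySection x y) xGy) countable
    where
    countable : AtMostCountable (EmptySection D x)
    countable = let c , c-injective = loc x (y , xGy) in
      c , λ {y} {y′} p q →
        c-injective (from (G⇔EmptySection x y) p) (from (G⇔EmptySection x y′) q)
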